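{- Let a hidden K-GLCP$(M,q)$ of type $b\in\mathbb N^n$ be given, let $(X,Y)$ be a hidden K-witness of $M$, and let $f\in\mathbb R^n$ with $f>\mathbf 0$. Then a set $N\subseteq N(b+\mathbf 1)$ is a solution basis to the hidden K-GLCP$(M,q)$ if and only if $N\cup\{(j,b_j+2): j\in[n]\}$ is a solution basis to the K-GLCP$([Y|X],[q-Mf\,|\,-f])$ of type $b+\mathbf 1$. Moreover (assuming nondegeneracy, so that the USOs are defined), the USO of the grid $G(b+\mathbf 1)$ arising from the hidden K-GLCP is fully contained in the USO of the grid $G(b+\mathbf 2)$ arising from the K-GLCP, i.e. it is the restriction of the latter to the subgrid induced by $N(b+\mathbf 1)\subseteq N(b+\mathbf 2)$.
   Context: Write $[n]=\{1,\dots,n\}$; $\mathbf 1,\mathbf 2$ are constant vectors. A block matrix of type $b=(b_1,\dots,b_n)$ ($b_j$ positive integers) is a real $m\times n$ matrix, $m=\sum_jb_j$, whose rows are partitioned into $n$ consecutive blocks, block $j$ having $b_j$ rows; rows are indexed by $N(b)=\{(j,i): j\in[n], i\in[b_j]\}$. For an $n\times n$ matrix $X$, $[M|X]$ is the block matrix of type $b+\mathbf 1$ obtained by appending the $j$-th row of $X$ as last row (index $(j,b_j+1)$) of block $j$; similarly for block vectors. $B\subseteq N(b)$ is maximal complementary if it contains exactly one $(j,i)$ for each $j$; then the $n\times n$ matrix $M_B$ of rows in $B$ is a representative submatrix. A square matrix is a P-matrix if all principal minors are positive, a Z-matrix if off-diagonal entries are nonpositive, a K-matrix if it is both; a block matrix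 is a P-, Z- or K-matrix if every representative submatrix is. $M$ of type $b$ is a hidden Z-matrix if there is a hidden Z-witness $(X,Y,r,s)$: a square Z-matrix $X\in\mathbb R^{n\times n}$, a block Z-matrix $Y$ of type $b$, and $r,s\ge\mathbf 0$ with $MX=Y$, $X^Tr+Y^Ts>\mathbf 0$. It is a hidden K-matrix if it is moreover a P-matrix; then a hidden K-witness of $M$ is a pair $(X,Y)$ that is part of some hidden Z-witness $(X,Y,r,s)$ of $M$ (in this case $[Y|X]$ is a block K-matrix). GLCP$(M,q)$ of type $b$: find $z\in\mathbb R^n$, $w\in\mathbb R^m$ with $w-Mz=q$, $w,z\ge\mathbf 0$, $z_j\prod_{i=1}^{b_j}w^j_i=0$ for all $j$. It is called a P-, K- or hidden K-GLCP according to the class of $M$. $[I|-M]$ is the $m\times(m+n)$ matrix with columns indexed by $N(b+\mathbf 1)$: column $(j,i)$, $i\le b_j$, is the unit vector $e_{(j,i)}$; column $(j,b_j+1)$ is minus the $j$-th column of $M$. A solution basis is a set $N=N(b+\mathbf 1)\setminus B$, with $B\subseteq N(b+\mathbf 1)$ maximal complementary, such that $[I|-M]_Nx=q$, $x\ge\mathbf 0$ is feasible. The grid $G(b)$ is the graph whose vertices are the maximal complementary subsets of $N(b)$, two being adjacent if they differ in exactly one element; the subgrid induced by a subset of $N(b)$ is the subgraph induced by the vertices contained in that subset. The USO (unique-sink orientation) arising from a P-GLCP$(M,q)$ of type $b$ is the orientation of $G(b+\mathbf 1)$ in which, for adjacent $B$ and $C=(B\setminus\{(j,i)\})\cup\{(j,k)\}$,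 $B\to C$ iff $([I|-M]_N^{ -1}q)^j_k<0$, $N=N(b+\mathbf 1)\setminus B$ (vector indexed by $N$). Nondegeneracy: none of these entries is zero. -}

module Defs where

open import Level using (Level; 0ℓ; _⊔_) renaming (suc to lsuc)
open import Algebra.Bundles using (CommutativeRing)
import Algebra.Properties.CommutativeMonoid.Sum as Sum
import Algebra.Properties.Semiring.Exp as Exp
open import Data.Bool.Base using (if_then_else_)
open import Data.Fin.Base as Fin using (Fin; zero; suc; toℕ; punchIn; _↑ˡ_; _↑ʳ_)
import Data.Fin.Properties as Fin
open import Data.Nat.Base as ℕ using (ℕ; zero; suc)
open import Data.Product.Base using (Σ; ∃; ∃₂; _×_; _,_; proj₁; proj₂)
open import Data.Product using (∃!)
open import Data.Product.Properties using (≡-dec)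
open import Data.Vec.Functional using (Vector; []; _∷_; _++_)
open import Relation.Binary.Core using (Rel; _Preserves_⟶_)
open import Relation.Binary.Definitions using (DecidableEquality)
open import Relation.Binary.PropositionalEquality.Core using (_≡_; _≢_)
open import Relation.Binary.Structures using (IsStrictTotalOrder)
import Relation.Binary.Construct.StrictToNonStrict as StrictToNonStrict
open import Relation.Nullary using (¬_; does)
open import Relation.Unary using (Pred; _∈_; _∉_; _≐_; ∁; _∪_; _∖_; ｛_｝)

-- The scalars.  The library has no real numbers; everything below is stated
-- over an arbitrary (discretely) ordered field, of which ℝ is classically an
-- instance.
record OrderedField c ℓ₁ ℓ₂ : Set (lsuc (c ⊔ ℓ₁ ⊔ ℓ₂)) where
  infix 4 _<_
  field
    commutativeRing : CommutativeRing c ℓ₁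
  open CommutativeRing commutativeRing public
  field
    _<_                : Rel Carrier ℓ₂
    isStrictTotalOrder : IsStrictTotalOrder _≈_ _<_
    +-monoʳ-<          : ∀ x {y z} → y < z → x + y < x + z
    *-pos              : ∀ {x y} → 0# < x → 0# < y → 0# < x * y
    0≉1                : ¬ (0# ≈ 1#)
    inverse            : ∀ x → ¬ (x ≈ 0#) → ∃ λ y → x * y ≈ 1#
  open StrictToNonStrict _≈_ _<_ public using (_≤_)

private
  variable
    a : Level
    A : Set a
    n : ℕ
    b b′ : Vector ℕ n

-- A block type is b : Vector ℕ n.  Positivity of its entries is a separate
-- hypothesis.

_+𝟏 : Vector ℕ n → Vector ℕ n
(b +𝟏) j = b j ℕ.+ 1

-- N(b)
Idx : Vector ℕ n → Set
Idx {n} b = Σ (Fin n) λ j → Fin (b j)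

_≟_ : DecidableEquality (Idx b)
_≟_ = ≡-dec Fin._≟_ Fin._≟_

-- The inclusion N(b) ⊆ N(b + 𝟏) and the elements (j , b_j + 1).
ι : Idx b → Idx (b +𝟏)
ι (j , i) = j , i ↑ˡ 1

new : (b : Vector ℕ n) → Fin n → Idx (b +𝟏)
new b j = j , b j ↑ʳ zero

-- A subset of N(b) regarded as a subset of N(b + 𝟏).
↑ : Pred (Idx b) 0ℓ → Pred (Idx (b +𝟏)) 0ℓ
↑ S p = ∃ λ p′ → p′ ∈ S × p ≡ ι p′

New : (b : Vector ℕ n) → Pred (Idx (b +𝟏)) 0ℓ
New b p = ∃ λ j → p ≡ new b j

-- Entry (or row) j of x becomes the last entry (or row) of block j of v.
[_∣_] : {b : Vector ℕ n} → (Idx b → A) → Vector A n → Idx (b +𝟏) → A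
[ v ∣ x ] (j , i) = ((λ k → v (j , k)) ++ (x j ∷ [])) i

MaximalComplementary : Pred (Idx b) 0ℓ → Set
MaximalComplementary B = ∀ j → ∃! _≡_ λ i → (j , i) ∈ B

module GLCP {c ℓ₁ ℓ₂} (F : OrderedField c ℓ₁ ℓ₂) where

  open OrderedField F hiding (zero)
  open Sum +-commutativeMonoid using (sum)
  open Exp semiring using (_^_)

  SquareMatrix : ℕ → Set c
  SquareMatrix n = Fin n → Vector Carrier n

  BlockVector : Vector ℕ n → Set c
  BlockVector b = Idx b → Carrier

  BlockMatrix : Vector ℕ n → Set c
  BlockMatrix {n} b = Idx b → Vector Carrier n

  sumᵇ : BlockVector b → Carrier
  sumᵇ v = sum λ j → sum λ i → v (j , i)

  δ : Idx b → Idx b → Carrier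
  δ p q = if does (p ≟ q) then 1# else 0#

  infixl 7 _·_ _·ᵥ_

  _·_ : {R : Set} → (R → Vector Carrier n) → SquareMatrix n → R → Vector Carrier n
  (M · X) p l = sum λ k → M p k * X k l

  _·ᵥ_ : {R : Set} → (R → Vector Carrier n) → Vector Carrier n → R → Carrier
  (M ·ᵥ z) p = sum λ k → M p k * z k

  det : SquareMatrix n → Carrier
  det {zero}  A = 1#
  det {suc n} A =
    sum λ j → (- 1#) ^ toℕ j * (A zero j * det λ i k → A (suc i) (punchIn j k))

  -- Index sets of principal minors are presented by their increasing
  -- enumerations.
  IsPMatrix : SquareMatrix n → Set ℓ₂
  IsPMatrix {n} A = ∀ {k} (f : Fin k → Fin n) → f Preserves Fin._<_ ⟶ Fin._<_ →
    0# < det λ i j → A (f i) (f j)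

  IsZMatrix : SquareMatrix n → Set (ℓ₁ ⊔ ℓ₂)
  IsZMatrix A = ∀ i j → i ≢ j → A i j ≤ 0#

  representative : {b : Vector ℕ n} → BlockMatrix b → {B : Pred (Idx b) 0ℓ} →
                   MaximalComplementary B → SquareMatrix n
  representative M mc j = M (j , proj₁ (mc j))

  IsBlockPMatrix : BlockMatrix b → Set (lsuc 0ℓ ⊔ ℓ₂)
  IsBlockPMatrix {b = b} M = {B : Pred (Idx b) 0ℓ} (mc : MaximalComplementary B) →
    IsPMatrix (representative M mc)

  IsBlockZMatrix : BlockMatrix b → Set (lsuc 0ℓ ⊔ ℓ₁ ⊔ ℓ₂)
  IsBlockZMatrix {b = b} M = {B : Pred (Idx b) 0ℓ} (mc : MaximalComplementary B) →
    IsZMatrix (representative M mc)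

  IsBlockKMatrix : BlockMatrix b → Set (lsuc 0ℓ ⊔ ℓ₁ ⊔ ℓ₂)
  IsBlockKMatrix M = IsBlockPMatrix M × IsBlockZMatrix M

  record IsHiddenZWitness {b : Vector ℕ n} (M : BlockMatrix b)
                          (X : SquareMatrix n) (Y : BlockMatrix b)
                          (r : Vector Carrier n) (s : BlockVector b)
                          : Set (lsuc 0ℓ ⊔ ℓ₁ ⊔ ℓ₂) where
    field
      X-isZ    : IsZMatrix X
      Y-isZ    : IsBlockZMatrix Y
      r≥0      : ∀ j → 0# ≤ r j
      s≥0      : ∀ p → 0# ≤ s p
      MX≈Y     : ∀ p l → (M · X) p l ≈ Y p l
      Xᵀr+Yᵀs>0 : ∀ l → 0# < (sum λ j → X j l * r j) + (sumᵇ λ p → Y p l * s p)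

  IsHiddenZMatrix : BlockMatrix b → Set (lsuc 0ℓ ⊔ c ⊔ ℓ₁ ⊔ ℓ₂)
  IsHiddenZMatrix M = ∃₂ λ X Y → ∃₂ λ r s → IsHiddenZWitness M X Y r s

  IsHiddenKMatrix : BlockMatrix b → Set (lsuc 0ℓ ⊔ c ⊔ ℓ₁ ⊔ ℓ₂)
  IsHiddenKMatrix M = IsHiddenZMatrix M × IsBlockPMatrix M

  IsHiddenKWitness : {b : Vector ℕ n} →
                     BlockMatrix b → SquareMatrix n → BlockMatrix b →
                     Set (lsuc 0ℓ ⊔ c ⊔ ℓ₁ ⊔ ℓ₂)
  IsHiddenKWitness M X Y =
    IsHiddenKMatrix M × ∃₂ λ r s → IsHiddenZWitness M X Y r s

  -- The matrix [I | -M]; its column (j , b_j + 1) is minus column j of M.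
  [I∣-_] : BlockMatrix b → Idx b → Idx (b +𝟏) → Carrier
  [I∣- M ] p = [ δ p ∣ (λ j → - M p j) ]

  -- For a set N of column indices, a vector indexed by N is represented by
  -- its extension by zero to all column indices, so that A_N x = A x.
  _SupportedOn_ : BlockVector b → Pred (Idx b) 0ℓ → Set ℓ₁
  x SupportedOn N = ∀ p → p ∉ N → x p ≈ 0#

  IsSolutionBasis : (M : BlockMatrix b) (q : BlockVector b) →
                    Pred (Idx (b +𝟏)) 0ℓ → Set (lsuc 0ℓ ⊔ c ⊔ ℓ₁ ⊔ ℓ₂)
  IsSolutionBasis M q N =
    (∃ λ B → MaximalComplementary B × N ≐ ∁ B) ×
    (∃ λ x → x SupportedOn N ×
             (∀ p → (sumᵇ λ k → [I∣- M ] p k * x k) ≈ q p) ×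
             (∀ k → 0# ≤ x k))

  -- G = (A_N)⁻¹, its rows being indexed by N and extended by zero as above.
  record IsInverse (A : Idx b → Idx b′ → Carrier) (N : Pred (Idx b′) 0ℓ)
                   (G : Idx b′ → Idx b → Carrier) : Set ℓ₁ where
    field
      supported    : ∀ p → (λ k → G k p) SupportedOn N
      rightInverse : ∀ p p′ → (sumᵇ λ k → A p k * G k p′) ≈ δ p p′
      leftInverse  : ∀ {k k′} → k ∈ N → k′ ∈ N →
                     (sumᵇ λ p → G k p * A p k′) ≈ δ k k′

  Nondegenerate : BlockMatrix b → BlockVector b → Set (lsuc 0ℓ ⊔ c ⊔ ℓ₁)
  Nondegenerate {b = b} M q =
    {B : Pred (Idx (b +𝟏)) 0ℓ} → MaximalComplementary B →
    ∀ {G} → IsInverse [I∣- M ] (∁ B) G →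
    ∀ {k} → k ∉ B → ¬ ((sumᵇ λ p → G k p * q p) ≈ 0#)

  -- The arc B → C of the orientation of G(b + 𝟏).  For a P-matrix M the
  -- inverse G exists and is unique.
  _,_⊢_⟶_ : (M : BlockMatrix b) (q : BlockVector b) →
            Rel (Pred (Idx (b +𝟏)) 0ℓ) (c ⊔ ℓ₁ ⊔ ℓ₂)
  M , q ⊢ B ⟶ C = ∃ λ j → ∃₂ λ i k →
    (j , i) ∈ B × (j , k) ∉ B ×
    C ≐ ((B ∖ ｛ j , i ｝) ∪ ｛ j , k ｝) ×
    ∃ λ G → IsInverse [I∣- M ] (∁ B) G × (sumᵇ λ p → G (j , k) p * q p) < 0#

-- Choose z′ = X⁻¹ (z + f).  Since M X = Y, a solution (w , z) of w − M z = q turns into the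
-- solution ((w , z) , z′) of the larger system, with the two systems sharing the vector
-- (w , z); and z′ ≥ 0 because X is a K-matrix.  The inverses of the basis matrices
-- correspond in the same way, so the entries deciding the arcs agree.
--
-- That [Y|X] is a block K-matrix is shown by exchanging rows.  The matrix A with rows
-- Aⱼ = rⱼ Xⱼ + Σᵢ sⱼᵢ Yⱼᵢ is a Z-matrix with Aᵀ𝟏 > 0, hence a K-matrix.  Replace its rows
-- one at a time by those of a representative.  If h replaces row j of a K-matrix H, let
-- v ≥ 0 solve H v = eⱼ.  Were h v ≤ 0, each block of [Y|X] v would have both an entry ≤ 0 and
-- an entry ≥ 0, so some representative submatrix of M would reverse the signs of X v.  As M
-- is a P-matrix, X v = 0, contradicting H v = eⱼ.  So h v > 0, and if H x > 0 for some
-- x ≥ 0, then x + t v shows for large t that the new matrix is again a K-matrix.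

module Submission where

open import Defs
open import Level using (Level; 0ℓ; _⊔_)
open import Algebra.Bundles using (RawRing)
import Algebra.Properties.AbelianGroup as AbelianGroupProperties
import Algebra.Properties.Ring as RingProperties
import Algebra.Properties.Semiring.Exp as Exp
import Algebra.Properties.Semiring.Sum as SemiringSum
import Algebra.Properties.Semiring.Mult as SemiringMult
import Algebra.Solver.Ring as RingSolver
open import Algebra.Solver.Ring.AlmostCommutativeRing using (AlmostCommutativeRing; fromCommutativeRing; _-Raw-AlmostCommutative⟶_)
open import Data.Bool.Base using (if_then_else_)
open import Data.Fin.Base as Fin using (Fin; zero; suc; toℕ; punchIn; _↑ˡ_; _↑ʳ_)
import Data.Fin.Properties as Fin
open import Data.Maybe.Base using (Maybe; just; nothing)
open import Data.Nat.Base as ℕ using (ℕ; zero; suc; NonZero)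
import Data.Nat.Properties as ℕ
open import Data.Product.Base using (∃; _×_; _,_; proj₁; proj₂)
import Data.Product.Properties.WithK as Product
open import Data.Sum.Base using (_⊎_; inj₁; inj₂)
open import Data.Vec.Functional using (Vector; []; _∷_; tail; updateAt)
open import Data.Vec.Functional.Properties using (lookup-++ˡ; lookup-++ʳ; updateAt-updates; updateAt-minimal)
open import Relation.Unary using (Pred; _∈_; _∉_; _≐_; ∁; _∪_; _∖_; ｛_｝)
open import Function.Base using (_∘_; id; case_of_)
open import Function.Bundles using (_⇔_; mk⇔)
open import Relation.Binary.Definitions using (tri<; tri≈; tri>)
open import Relation.Binary.PropositionalEquality.Core as ≡ using (_≡_; _≢_)
import Relation.Binary.Reasoning.Setoid as SetoidReasoning
open import Relation.Binary.Structures using (IsStrictTotalOrder)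
open import Relation.Nullary using (¬_; Dec; does; yes; no; contradiction)

-- The witness condition controls only one combination of the rows of all blocks, so even the
-- invertibility of `X` has to be derived. The working form of the K-property is therefore
-- semipositivity: a Z-matrix `A` with some `x ≥ 0` and `A x > 0`. Unlike positivity of minors, it
-- is carried by an explicit vector, which survives Schur complements, passage to principal
-- submatrices and the repair of an exchanged row. Induction on Schur complements then yields
-- positive determinants, monotonicity and a nonnegative inverse. Determinants matter only at the
-- two ends: to extract the sign-reversal property from the minors of `M`, and to return from
-- semipositivity to the minors of `[Y|X]`.
--
-- For the arcs, a row `g` of the inverse of a basis matrix is lengthened to `[g | -gM]`. This row
-- annihilates `[Y|X]`, because `gY - gMX = 0`, and its product with the new right-hand side is
-- `g(q - Mf) + gMf = gq`. The rows of the larger inverse that have old indices are exactly these,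
-- which is why the entries compared by the two orientations coincide.

module Theory {c ℓ₁ ℓ₂} (F : OrderedField c ℓ₁ ℓ₂) where

  open OrderedField F hiding (zero)
  open GLCP F
  private module < = IsStrictTotalOrder isStrictTotalOrder
  open Exp semiring using (_^_)
  open RingProperties ring using (-0#≈0#; -‿distribˡ-*; -‿distribʳ-*; -‿involutive; -1*x≈-x)
  open AbelianGroupProperties +-abelianGroup using () renaming (⁻¹-∙-comm to -‿+-comm)
  open SemiringSum semiring
  open SetoidReasoning setoid

  private
    variable
      m n : ℕ
      b : Vector ℕ n
      ℓ : Level
      A : Set ℓ

  -- The pair (p , q) stands for the integer p − q.  Literal coefficients let
  -- the solver cancel, which it cannot do with coefficients in the abstract
  -- field itself.
  module _ where
    open SemiringMult semiring using (×-homo-+; ×1-homo-*) renaming (_×_ to _∙_)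

    private
      differences : RawRing 0ℓ 0ℓ
      differences = record
        { Carrier = ℕ × ℕ
        ; _≈_ = _≡_
        ; _+_ = λ (p , q) (r , s) → p ℕ.+ r , q ℕ.+ s
        ; _*_ = λ (p , q) (r , s) → p ℕ.* r ℕ.+ q ℕ.* s , p ℕ.* s ℕ.+ q ℕ.* r
        ; -_  = λ (p , q) → q , p
        ; 0#  = 0 , 0
        ; 1#  = 1 , 0
        }

      module D = RawRing differences

      ⟦_⟧ : D.Carrier → Carrier
      ⟦ p , q ⟧ = p ∙ 1# + - (q ∙ 1#)

      interchange : ∀ w x y z → (w + x) + (y + z) ≈ (w + y) + (x + z)
      interchange w x y z = begin
        (w + x) + (y + z) ≈⟨ +-assoc w x _ ⟩
        w + (x + (y + z)) ≈⟨ +-congˡ (+-assoc x y z) ⟨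
        w + ((x + y) + z) ≈⟨ +-congˡ (+-congʳ (+-comm x y)) ⟩
        w + ((y + x) + z) ≈⟨ +-congˡ (+-assoc y x z) ⟩
        w + (y + (x + z)) ≈⟨ +-assoc w y _ ⟨
        (w + y) + (x + z) ∎

      ⟦⟧-homo-+ : ∀ u v → ⟦ u D.+ v ⟧ ≈ ⟦ u ⟧ + ⟦ v ⟧
      ⟦⟧-homo-+ (p , q) (r , s) = begin
        (p ℕ.+ r) ∙ 1# + - ((q ℕ.+ s) ∙ 1#)
          ≈⟨ +-cong (×-homo-+ 1# p r) (trans (-‿cong (×-homo-+ 1# q s)) (sym (-‿+-comm _ _))) ⟩
        (p ∙ 1# + r ∙ 1#) + (- (q ∙ 1#) + - (s ∙ 1#)) ≈⟨ interchange _ _ _ _ ⟩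
        ⟦ p , q ⟧ + ⟦ r , s ⟧ ∎

      ×-homo-+* : ∀ p q r s → (p ℕ.* q ℕ.+ r ℕ.* s) ∙ 1# ≈ (p ∙ 1#) * (q ∙ 1#) + (r ∙ 1#) * (s ∙ 1#)
      ×-homo-+* p q r s = trans (×-homo-+ 1# (p ℕ.* q) (r ℕ.* s)) (+-cong (×1-homo-* p q) (×1-homo-* r s))

      ⟦⟧-homo-* : ∀ u v → ⟦ u D.* v ⟧ ≈ ⟦ u ⟧ * ⟦ v ⟧
      ⟦⟧-homo-* (p , q) (r , s) = sym (begin
        (P + - Q) * (R + - S)                         ≈⟨ distribˡ _ R (- S) ⟩
        (P + - Q) * R + (P + - Q) * - S               ≈⟨ +-cong (distribʳ R P _) (distribʳ _ P _) ⟩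
        (P * R + - Q * R) + (P * - S + - Q * - S)     ≈⟨ +-congˡ (+-comm _ _) ⟩
        (P * R + - Q * R) + (- Q * - S + P * - S)     ≈⟨ interchange _ _ _ _ ⟩
        (P * R + - Q * - S) + (- Q * R + P * - S)
          ≈⟨ +-cong (+-congˡ (trans (sym (-‿distribˡ-* Q _)) (trans (-‿cong (sym (-‿distribʳ-* Q S))) (-‿involutive _))))
                    (trans (+-comm _ _) (+-cong (sym (-‿distribʳ-* P S)) (sym (-‿distribˡ-* Q R)))) ⟩
        (P * R + Q * S) + (- (P * S) + - (Q * R))     ≈⟨ +-congˡ (-‿+-comm _ _) ⟩
        (P * R + Q * S) + - (P * S + Q * R)           ≈⟨ +-cong (×-homo-+* p r q s) (-‿cong (×-homo-+* p s q r)) ⟨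
        ⟦ (p , q) D.* (r , s) ⟧                       ∎)
        where
        P = p ∙ 1#
        Q = q ∙ 1#
        R = r ∙ 1#
        S = s ∙ 1#

      almostCommutativeRing : AlmostCommutativeRing c ℓ₁
      almostCommutativeRing = fromCommutativeRing commutativeRing

      morphism : differences -Raw-AlmostCommutative⟶ almostCommutativeRing
      morphism = record
        { ⟦_⟧    = ⟦_⟧
        ; +-homo = ⟦⟧-homo-+
        ; *-homo = ⟦⟧-homo-*
        ; -‿homo = λ (p , q) → trans (+-comm _ _) (trans (+-congˡ (sym (-‿involutive _))) (-‿+-comm _ _))
        ; 0-homo = -‿inverseʳ 0#
        ; 1-homo = trans (+-cong (+-identityʳ 1#) -0#≈0#) (+-identityʳ 1#)
        }

      -- Different pairs may stand for the same integer, so coefficients are compared by cross sums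
      -- and not componentwise.
      ⟦⟧-cong? : ∀ u v → Maybe (⟦ u ⟧ ≈ ⟦ v ⟧)
      ⟦⟧-cong? (p , q) (r , s) with p ℕ.+ s ℕ.≟ r ℕ.+ q
      ... | no _  = nothing
      ... | yes e = just (begin
        P + - Q                     ≈⟨ +-identityʳ _ ⟨
        (P + - Q) + 0#              ≈⟨ +-congˡ (-‿inverseʳ S) ⟨
        (P + - Q) + (S + - S)       ≈⟨ interchange _ _ _ _ ⟩
        (P + S) + (- Q + - S)       ≈⟨ +-cong (trans (sym (×-homo-+ 1# p s)) (trans (reflexive (≡.cong (_∙ 1#) e)) (×-homo-+ 1# r q))) (+-comm _ _) ⟩
        (R + Q) + (- S + - Q)       ≈⟨ interchange _ _ _ _ ⟩
        (R + - S) + (Q + - Q)       ≈⟨ +-congˡ (-‿inverseʳ Q) ⟩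
        (R + - S) + 0#              ≈⟨ +-identityʳ _ ⟩
        R + - S                     ∎)
        where
        P = p ∙ 1#
        Q = q ∙ 1#
        R = r ∙ 1#
        S = s ∙ 1#

    open RingSolver differences almostCommutativeRing morphism ⟦⟧-cong? public
      using (solve; _:=_; _:+_; _:*_; _:-_; :-_)

  -- Order arithmetic of the field.

  module _ where

    private
      variable
        x y z : Carrier

    0<-resp-≈ : x ≈ y → 0# < x → 0# < y
    0<-resp-≈ = <.<-respʳ-≈

    0≤-resp-≈ : x ≈ y → 0# ≤ x → 0# ≤ y
    0≤-resp-≈ e (inj₁ p) = inj₁ (0<-resp-≈ e p)
    0≤-resp-≈ e (inj₂ p) = inj₂ (trans p e)

    0<x∧0≤y⇒0<x+y : 0# < x → 0# ≤ y → 0# < x + y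
    0<x∧0≤y⇒0<x+y 0<x (inj₁ 0<y) = <.trans 0<x (<.<-respˡ-≈ (+-identityʳ _) (+-monoʳ-< _ 0<y))
    0<x∧0≤y⇒0<x+y 0<x (inj₂ 0≈y) = 0<-resp-≈ (trans (sym (+-identityʳ _)) (+-congˡ 0≈y)) 0<x

    0≤x∧0<y⇒0<x+y : 0# ≤ x → 0# < y → 0# < x + y
    0≤x∧0<y⇒0<x+y p q = 0<-resp-≈ (+-comm _ _) (0<x∧0≤y⇒0<x+y q p)

    0≤x∧0≤y⇒0≤x+y : 0# ≤ x → 0# ≤ y → 0# ≤ x + y
    0≤x∧0≤y⇒0≤x+y (inj₁ p) q = inj₁ (0<x∧0≤y⇒0<x+y p q)
    0≤x∧0≤y⇒0≤x+y (inj₂ p) q = 0≤-resp-≈ (trans (sym (+-identityˡ _)) (+-congʳ p)) q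

    0≤x∧0≤y⇒0≤x*y : 0# ≤ x → 0# ≤ y → 0# ≤ x * y
    0≤x∧0≤y⇒0≤x*y (inj₁ p) (inj₁ q) = inj₁ (*-pos p q)
    0≤x∧0≤y⇒0≤x*y (inj₁ p) (inj₂ q) = inj₂ (trans (sym (zeroʳ _)) (*-congˡ q))
    0≤x∧0≤y⇒0≤x*y (inj₂ p) q        = inj₂ (trans (sym (zeroˡ _)) (*-congʳ p))

    x<0⇒0<-x : x < 0# → 0# < - x
    x<0⇒0<-x {x} p = <.<-respˡ-≈ (-‿inverseˡ x) (<.<-respʳ-≈ (+-identityʳ _) (+-monoʳ-< (- x) p))

    0<-x⇒x<0 : 0# < - x → x < 0#
    0<-x⇒x<0 {x} p = <.<-respˡ-≈ (+-identityʳ x) (<.<-respʳ-≈ (-‿inverseʳ x) (+-monoʳ-< x p))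

    x≤0⇒0≤-x : x ≤ 0# → 0# ≤ - x
    x≤0⇒0≤-x (inj₁ p) = inj₁ (x<0⇒0<-x p)
    x≤0⇒0≤-x (inj₂ p) = inj₂ (sym (trans (-‿cong p) -0#≈0#))

    0≤-x⇒x≤0 : 0# ≤ - x → x ≤ 0#
    0≤-x⇒x≤0 (inj₁ p) = inj₁ (0<-x⇒x<0 p)
    0≤-x⇒x≤0 {x} (inj₂ p) = inj₂ (trans (sym (-‿involutive x)) (trans (-‿cong (sym p)) -0#≈0#))

    0≤x⇒-x≤0 : 0# ≤ x → - x ≤ 0#
    0≤x⇒-x≤0 p = 0≤-x⇒x≤0 (0≤-resp-≈ (sym (-‿involutive _)) p)

    <⇒≱ : x < 0# → ¬ 0# ≤ x
    <⇒≱ p (inj₁ q) = <.asym p q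
    <⇒≱ p (inj₂ q) = <.irrefl (sym q) p

    ≤⇒≯ : x ≤ 0# → ¬ 0# < x
    ≤⇒≯ (inj₁ p) q = <.asym p q
    ≤⇒≯ (inj₂ p) q = <.irrefl (sym p) q

    0≤-antisym : 0# ≤ x → 0# ≤ - x → x ≈ 0#
    0≤-antisym (inj₁ p) q = contradiction p (≤⇒≯ (0≤-x⇒x≤0 q))
    0≤-antisym (inj₂ p) q = sym p

    0<1 : 0# < 1#
    0<1 with <.compare 0# 1#
    ... | tri< p _ _ = p
    ... | tri≈ _ p _ = contradiction p 0≉1
    ... | tri> _ _ p = 0<-resp-≈ (trans (solve 1 (λ x → :- x :* :- x := x :* x) refl 1#) (*-identityˡ 1#)) (*-pos (x<0⇒0<-x p) (x<0⇒0<-x p))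

    -- Here the order excludes characteristic two; without this, antisymmetry of the determinant
    -- would not make it vanish on equal rows.
    x≈-x⇒x≈0 : x ≈ - x → x ≈ 0#
    x≈-x⇒x≈0 {x} e with <.compare x 0#
    ... | tri< p _ _ = contradiction (0<-resp-≈ (sym e) (x<0⇒0<-x p)) (<.asym p)
    ... | tri≈ _ p _ = p
    ... | tri> _ _ p = contradiction (0<-x⇒x<0 (0<-resp-≈ e p)) (<.asym p)

    positive-inverse : 0# < x → ∃ λ y → x * y ≈ 1# × 0# < y
    positive-inverse {x} 0<x with inverse x (λ e → <.irrefl (sym e) 0<x)
    ... | y , xy≈1 with <.compare 0# y
    ...   | tri< p _ _ = y , xy≈1 , p
    ...   | tri≈ _ p _ = contradiction (trans (sym (zeroʳ x)) (trans (*-congˡ p) xy≈1)) 0≉1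
    ...   | tri> _ _ p = contradiction (0<-x⇒x<0 (0<-resp-≈ (trans (sym (-‿distribʳ-* x y)) (-‿cong xy≈1)) (*-pos 0<x (x<0⇒0<-x p)))) (<.asym 0<1)

    cancel-positive : ∀ {x y z} → x * y ≈ 1# → y * (x * z) ≈ z
    cancel-positive {x} {y} {z} e = begin
      y * (x * z) ≈⟨ solve 3 (λ x y z → y :* (x :* z) := (x :* y) :* z) refl x y z ⟩
      (x * y) * z ≈⟨ *-congʳ e ⟩
      1# * z      ≈⟨ *-identityˡ z ⟩
      z           ∎

    0<-cancelˡ-* : 0# < x → 0# < x * y → 0# < y
    0<-cancelˡ-* p q with positive-inverse p
    ... | _ , e , r = 0<-resp-≈ (cancel-positive e) (*-pos r q)

    0≤-cancelˡ-* : 0# < x → 0# ≤ x * y → 0# ≤ y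
    0≤-cancelˡ-* p q with positive-inverse p
    ... | _ , e , r = 0≤-resp-≈ (cancel-positive e) (0≤x∧0≤y⇒0≤x*y (inj₁ r) q)

    x*y≈0⇒y≈0 : ¬ x ≈ 0# → x * y ≈ 0# → y ≈ 0#
    x*y≈0⇒y≈0 {x} {y} x≉0 e with inverse x x≉0
    ... | x⁻¹ , i = trans (sym (cancel-positive i)) (trans (*-congˡ e) (zeroʳ x⁻¹))

  _≟0 : ∀ x → Dec (x ≈ 0#)
  x ≟0 = x <.≟ 0#

  ≤0-resp-≈ : ∀ {x y} → x ≈ y → x ≤ 0# → y ≤ 0#
  ≤0-resp-≈ e (inj₁ p) = inj₁ (<.<-respˡ-≈ e p)
  ≤0-resp-≈ e (inj₂ p) = inj₂ (trans (sym e) p)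

  0≤x*x : ∀ x → 0# ≤ x * x
  0≤x*x x with <.compare x 0#
  ... | tri< p _ _ = 0≤-resp-≈ (solve 1 (λ x → :- x :* :- x := x :* x) refl x) (0≤x∧0≤y⇒0≤x*y (inj₁ (x<0⇒0<-x p)) (inj₁ (x<0⇒0<-x p)))
  ... | tri≈ _ p _ = inj₂ (sym (trans (*-congʳ p) (zeroˡ x)))
  ... | tri> _ _ p = 0≤x∧0≤y⇒0≤x*y (inj₁ p) (inj₁ p)

  0<-cancelʳ-* : ∀ {x y} → 0# ≤ y → 0# < x * y → 0# < x
  0<-cancelʳ-* (inj₁ p) q = 0<-cancelˡ-* p (0<-resp-≈ (*-comm _ _) q)
  0<-cancelʳ-* (inj₂ p) q = contradiction q (<.irrefl (sym (trans (*-congˡ (sym p)) (zeroʳ _))))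

  x≤0∧0≤y⇒0≤-x*y : ∀ {x y} → x ≤ 0# → 0# ≤ y → 0# ≤ - (x * y)
  x≤0∧0≤y⇒0≤-x*y {x} {y} p q = 0≤-resp-≈ (solve 2 (λ x y → :- x :* y := :- (x :* y)) refl x y) (0≤x∧0≤y⇒0≤x*y (x≤0⇒0≤-x p) q)

  ≰⇒> : ∀ {x} → ¬ x ≤ 0# → 0# < x
  ≰⇒> {x} x≰0 with <.compare x 0#
  ... | tri< p _ _ = contradiction (inj₁ p) x≰0
  ... | tri≈ _ p _ = contradiction (inj₂ p) x≰0
  ... | tri> _ _ p = p

  _≤?0 : ∀ x → Dec (x ≤ 0#)
  x ≤?0 with <.compare x 0#
  ... | tri< p _ _ = yes (inj₁ p)
  ... | tri≈ _ p _ = yes (inj₂ p)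
  ... | tri> _ _ p = no λ q → ≤⇒≯ q p

  -- Signs and linearity of finite sums.

  sum≈0 : {t : Vector Carrier n} → (∀ i → t i ≈ 0#) → sum t ≈ 0#
  sum≈0 {n} p = trans (sum-cong-≋ p) (sum-replicate-zero n)

  sum-nonneg : {t : Vector Carrier n} → (∀ i → 0# ≤ t i) → 0# ≤ sum t
  sum-nonneg {zero}  p = inj₂ refl
  sum-nonneg {suc n} p = 0≤x∧0≤y⇒0≤x+y (p zero) (sum-nonneg (p ∘ suc))

  sum-pos : {t : Vector Carrier n} → (∀ i → 0# ≤ t i) → ∀ j → 0# < t j → 0# < sum t
  sum-pos p zero    q = 0<x∧0≤y⇒0<x+y q (sum-nonneg (p ∘ suc))
  sum-pos p (suc j) q = 0≤x∧0<y⇒0<x+y (p zero) (sum-pos (p ∘ suc) j q)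

  sum-neg : (t : Vector Carrier n) → - sum t ≈ sum (-_ ∘ t)
  sum-neg {zero}  t = -0#≈0#
  sum-neg {suc n} t = trans (sym (-‿+-comm _ _)) (+-congˡ (sum-neg (tail t)))

  sum-single : ∀ {t : Vector Carrier n} j → (∀ i → i ≢ j → t i ≈ 0#) → sum t ≈ t j
  sum-single zero    p = trans (+-congˡ (sum≈0 (λ i → p (suc i) λ ()))) (+-identityʳ _)
  sum-single (suc j) p = trans (+-cong (p zero λ ()) (sum-single j (λ i i≢j → p (suc i) (i≢j ∘ Fin.suc-injective)))) (+-identityˡ _)

  sum-linear : ∀ (s t : Vector Carrier n) k → sum (λ i → s i + k * t i) ≈ sum s + k * sum t
  sum-linear s t k = trans (∑-distrib-+ s (λ i → k * t i)) (+-congˡ (sym (*-distribˡ-sum k t)))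

  -- Determinants

  infix 4 _≋_

  _≋_ : {R : Set} → (R → Vector Carrier n) → (R → Vector Carrier n) → Set ℓ₁
  A ≋ B = ∀ i k → A i k ≈ B i k

  sign : Fin n → Carrier
  sign j = (- 1#) ^ toℕ j

  minor : SquareMatrix (suc n) → Fin (suc n) → SquareMatrix n
  minor A j i k = A (suc i) (punchIn j k)

  term : SquareMatrix (suc n) → Vector Carrier (suc n)
  term A j = sign j * (A zero j * det (minor A j))

  det-cong : {A B : SquareMatrix n} → A ≋ B → det A ≈ det B
  det-cong {zero}  A≋B = refl
  det-cong {suc n} A≋B = sum-cong-≋ λ j →
    *-congˡ {sign j} (*-cong (A≋B zero j) (det-cong λ i k → A≋B (suc i) (punchIn j k)))

  -- The number of rows is independent of the number of columns, so that fixing the first row of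
  -- such a functional gives one of the same kind and inductions over rows can proceed.
  record IsRowLinear (Φ : (Fin m → Vector Carrier n) → Carrier) : Set (c ⊔ ℓ₁) where
    field
      cong   : ∀ {R S} → R ≋ S → Φ R ≈ Φ S
      linear : ∀ {R S T} i k → (∀ l → R i l ≈ S i l + k * T i l) →
               (∀ r → r ≢ i → ∀ l → R r l ≈ S r l) → (∀ r → r ≢ i → ∀ l → R r l ≈ T r l) →
               Φ R ≈ Φ S + k * Φ T

  det-linear : {A B C : SquareMatrix n} → ∀ i x → (∀ l → A i l ≈ B i l + x * C i l) →
               (∀ r → r ≢ i → ∀ l → A r l ≈ B r l) → (∀ r → r ≢ i → ∀ l → A r l ≈ C r l) →
               det A ≈ det B + x * det C
  det-linear {suc n} {A} {B} {C} zero x Aᵢ A≈B A≈C = begin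
    det A ≈⟨ sum-cong-≋ (λ j → begin
      sign j * (A zero j * det (minor A j)) ≈⟨ *-congˡ {sign j} (*-congʳ (Aᵢ j)) ⟩
      sign j * ((B zero j + x * C zero j) * det (minor A j))
        ≈⟨ solve 5 (λ s b c x d → s :* ((b :+ x :* c) :* d) := s :* (b :* d) :+ x :* (s :* (c :* d))) refl
             (sign j) (B zero j) (C zero j) x (det (minor A j)) ⟩
      sign j * (B zero j * det (minor A j)) + x * (sign j * (C zero j * det (minor A j)))
        ≈⟨ +-cong (*-congˡ {sign j} (*-congˡ (det-cong λ i k → A≈B (suc i) (λ ()) (punchIn j k))))
                  (*-congˡ (*-congˡ {sign j} (*-congˡ (det-cong λ i k → A≈C (suc i) (λ ()) (punchIn j k))))) ⟩
      sign j * (B zero j * det (minor B j)) + x * (sign j * (C zero j * det (minor C j))) ∎) ⟩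
    sum (λ j → term B j + x * term C j) ≈⟨ sum-linear (term B) (term C) x ⟩
    det B + x * det C ∎
  det-linear {suc n} {A} {B} {C} (suc i) x Aᵢ A≈B A≈C = begin
    det A ≈⟨ sum-cong-≋ (λ j → begin
      sign j * (A zero j * det (minor A j))
        ≈⟨ *-congˡ {sign j} (*-congˡ (det-linear i x (λ l → Aᵢ (punchIn j l))
             (λ r r≢i l → A≈B (suc r) (r≢i ∘ Fin.suc-injective) (punchIn j l))
             (λ r r≢i l → A≈C (suc r) (r≢i ∘ Fin.suc-injective) (punchIn j l)))) ⟩
      sign j * (A zero j * (det (minor B j) + x * det (minor C j)))
        ≈⟨ solve 5 (λ s a x b c → s :* (a :* (b :+ x :* c)) := s :* (a :* b) :+ x :* (s :* (a :* c))) refl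
             (sign j) (A zero j) x (det (minor B j)) (det (minor C j)) ⟩
      sign j * (A zero j * det (minor B j)) + x * (sign j * (A zero j * det (minor C j)))
        ≈⟨ +-cong (*-congˡ {sign j} (*-congʳ (A≈B zero (λ ()) j))) (*-congˡ (*-congˡ {sign j} (*-congʳ (A≈C zero (λ ()) j)))) ⟩
      sign j * (B zero j * det (minor B j)) + x * (sign j * (C zero j * det (minor C j))) ∎) ⟩
    sum (λ j → term B j + x * term C j) ≈⟨ sum-linear (term B) (term C) x ⟩
    det B + x * det C ∎

  det-isRowLinear : IsRowLinear (det {n})
  det-isRowLinear = record { cong = det-cong ; linear = det-linear }

  -- The Laplace expansion along the first two rows a and b; the minor left
  -- after removing two columns enters only through h.
  expand₂ : (a b : Vector Carrier (2 ℕ.+ n)) → ((Fin n → Fin (2 ℕ.+ n)) → Carrier) → Carrier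
  expand₂ a b h = sum λ j → sign j * (a j * sum λ k →
    sign k * (b (punchIn j k) * h (λ i → punchIn j (punchIn k i))))

  private
    -- The pairs of columns are sorted by column zero: `front a b` collects those in which row `a`
    -- takes it, `rest` those in which neither row does.
    front : (a b : Vector Carrier (2 ℕ.+ n)) → ((Fin n → Fin (2 ℕ.+ n)) → Carrier) → Carrier
    front a b h = a zero * sum λ k → sign k * (b (suc k) * h (λ i → suc (punchIn k i)))

    rest : (a b : Vector Carrier (2 ℕ.+ n)) → ((Fin n → Fin (2 ℕ.+ n)) → Carrier) → Carrier
    rest a b h = sum λ j → sign j * (a (suc j) * sum λ k →
      sign k * (b (suc (punchIn j k)) * h (λ i → punchIn (suc j) (punchIn (suc k) i))))

  -- Row `b` can take column zero only when `a` takes some column `suc j`, whose sign carries one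
  -- extra factor `- 1#`; this produces `- front b a h`. When both rows take later columns, the two
  -- extra factors cancel.
  expand₂-peel : ∀ (a b : Vector Carrier (2 ℕ.+ n)) h → expand₂ a b h ≈ (front a b h - front b a h) + rest a b h
  expand₂-peel {n} a b h = begin
    1# * front a b h + sum (λ j → (- 1# * sign j) * (a (suc j) * (1# * (b zero * H j) + sum λ k → (- 1# * sign k) * G j k)))
      ≈⟨ +-cong (*-identityˡ (front a b h)) (sum-cong-≋ split) ⟩
    front a b h + sum (λ j → U j + - b zero * V j)
      ≈⟨ +-congˡ (sum-linear U V (- b zero)) ⟩
    front a b h + (rest a b h + - b zero * sum V)
      ≈⟨ solve 4 (λ p r b s → p :+ (r :+ :- b :* s) := (p :- b :* s) :+ r) refl (front a b h) (rest a b h) (b zero) (sum V) ⟩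
    (front a b h - front b a h) + rest a b h ∎
    where
    H : Fin (suc n) → Carrier
    H j = h (λ i → suc (punchIn j i))
    G : Fin (suc n) → Fin n → Carrier
    G j k = b (suc (punchIn j k)) * h (λ i → punchIn (suc j) (punchIn (suc k) i))
    U V : Fin (suc n) → Carrier
    U j = sign j * (a (suc j) * sum λ k → sign k * G j k)
    V j = sign j * (a (suc j) * H j)

    negate : ∀ x y → (- 1# * x) * y ≈ - (x * y)
    negate x y = trans (*-congʳ (-1*x≈-x x)) (solve 2 (λ x y → :- x :* y := :- (x :* y)) refl x y)

    split : ∀ j → (- 1# * sign j) * (a (suc j) * (1# * (b zero * H j) + sum λ k → (- 1# * sign k) * G j k)) ≈ U j + - b zero * V j
    split j = begin
      (- 1# * sign j) * (a (suc j) * (1# * (b zero * H j) + sum λ k → (- 1# * sign k) * G j k))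
        ≈⟨ *-congˡ {(- 1#) * sign j} (*-congˡ {a (suc j)} (+-cong (*-identityˡ (b zero * H j)) (trans
             (sum-cong-≋ λ k → negate (sign k) (G j k)) (sym (sum-neg λ k → sign k * G j k))))) ⟩
      (- 1# * sign j) * (a (suc j) * (b zero * H j - sum λ k → sign k * G j k))
        ≈⟨ negate (sign j) (a (suc j) * (b zero * H j - sum λ k → sign k * G j k)) ⟩
      - (sign j * (a (suc j) * (b zero * H j - sum λ k → sign k * G j k)))
        ≈⟨ solve 5 (λ s a b h t → :- (s :* (a :* (b :* h :- t))) := s :* (a :* t) :+ :- b :* (s :* (a :* h))) refl
             (sign j) (a (suc j)) (b zero) (H j) (sum λ k → sign k * G j k) ⟩
      U j + - b zero * V j ∎

  -- Column zero survives in every term of `rest`. Removing it from the choice leaves a double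
  -- expansion with one column fewer, and `Fin.lift 1` puts it back among the surviving columns.
  rest-lower : ∀ (a b : Vector Carrier (3 ℕ.+ n)) h → (∀ {f g} → (∀ i → f i ≡ g i) → h f ≈ h g) →
               rest a b h ≈ expand₂ (tail a) (tail b) (h ∘ Fin.lift 1)
  rest-lower a b h h-cong = sum-cong-≋ λ j → *-congˡ {sign j} (*-congˡ {a (suc j)} (sum-cong-≋ λ k →
    *-congˡ {sign k} (*-congˡ {b (suc (punchIn j k))} (h-cong (lift-punchIn j k)))))
    where
    lift-punchIn : ∀ {n} (j : Fin (2 ℕ.+ n)) k i →
                   punchIn (suc j) (punchIn (suc k) i) ≡ Fin.lift 1 (λ i → punchIn j (punchIn k i)) i
    lift-punchIn j k zero    = ≡.refl
    lift-punchIn j k (suc i) = ≡.refl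

  -- After peeling, the `front` terms of the two orders cancel outright. The two `rest` terms are
  -- smaller double expansions, so induction applies; with only two columns they are empty sums.
  expand₂-antisym : ∀ (a b : Vector Carrier (2 ℕ.+ n)) h →
                    (∀ {f g} → (∀ i → f i ≡ g i) → h f ≈ h g) →
                    expand₂ a b h + expand₂ b a h ≈ 0#
  expand₂-antisym {n} a b h h-cong = begin
    expand₂ a b h + expand₂ b a h ≈⟨ +-cong (expand₂-peel a b h) (expand₂-peel b a h) ⟩
    ((front a b h - front b a h) + rest a b h) + ((front b a h - front a b h) + rest b a h)
      ≈⟨ solve 4 (λ p q r s → ((p :- q) :+ r) :+ ((q :- p) :+ s) := r :+ s) refl (front a b h) (front b a h) (rest a b h) (rest b a h) ⟩
    rest a b h + rest b a h ≈⟨ rest-antisym n a b h h-cong ⟩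
    0# ∎
    where
    rest-antisym : ∀ n (a b : Vector Carrier (2 ℕ.+ n)) h →
                   (∀ {f g} → (∀ i → f i ≡ g i) → h f ≈ h g) → rest a b h + rest b a h ≈ 0#
    rest-antisym zero a b h h-cong = trans (+-cong (vanish a) (vanish b)) (+-identityʳ 0#)
      where
      vanish : ∀ (a : Vector Carrier 2) → 1# * (a (suc zero) * 0#) + 0# ≈ 0#
      vanish a = trans (+-identityʳ _) (trans (*-congˡ (zeroʳ _)) (zeroʳ _))
    rest-antisym (suc n) a b h h-cong =
      trans (+-cong (rest-lower a b h h-cong) (rest-lower b a h h-cong))
            (expand₂-antisym (tail a) (tail b) (h ∘ Fin.lift 1) lift-cong)
      where
      lift-cong : ∀ {f g} → (∀ i → f i ≡ g i) → h (Fin.lift 1 f) ≈ h (Fin.lift 1 g)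
      lift-cong f≗g = h-cong λ where
        zero    → ≡.refl
        (suc i) → ≡.cong suc (f≗g i)

  det-swap : (A : SquareMatrix (2 ℕ.+ n)) →
             det A + det (A (suc zero) ∷ A zero ∷ tail (tail A)) ≈ 0#
  det-swap A = expand₂-antisym (A zero) (A (suc zero)) (λ f → det λ i l → A (suc (suc i)) (f l))
    (λ {f} {g} f≗g → det-cong {A = λ i l → A (suc (suc i)) (f l)} {λ i l → A (suc (suc i)) (g l)} λ i l → reflexive (≡.cong (A (suc (suc i))) (f≗g l)))

  -- If the equal rows are adjacent, swapping them changes nothing, so the determinant is its own
  -- negative. Otherwise a swap moves row zero into position one, and every minor along the new
  -- first row has a repeated row again.
  det-repeated-row : (A : SquareMatrix (suc n)) → ∀ i → (∀ l → A (suc i) l ≈ A zero l) → det A ≈ 0#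
  det-repeated-row {suc n} A zero e = x≈-x⇒x≈0 (begin
    det A              ≈⟨ solve 2 (λ x y → x := (x :+ y) :- y) refl (det A) (det B) ⟩
    (det A + det B) - det B ≈⟨ +-congʳ (det-swap A) ⟩
    0# - det B         ≈⟨ +-identityˡ _ ⟩
    - det B            ≈⟨ -‿cong (det-cong {A = B} {A} λ { zero → e ; (suc zero) → sym ∘ e ; (suc (suc i)) k → refl }) ⟩
    - det A            ∎)
    where B = A (suc zero) ∷ A zero ∷ tail (tail A)
  det-repeated-row {suc n} A (suc i) e = begin
    det A         ≈⟨ +-identityʳ _ ⟨
    det A + 0#    ≈⟨ +-congˡ (sum≈0 {t = term B} λ j → trans (*-congˡ {sign j} (trans (*-congˡ
                       (det-repeated-row (minor B j) i λ l → e (punchIn j l))) (zeroʳ _))) (zeroʳ _)) ⟨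
    det A + det B ≈⟨ det-swap A ⟩
    0#            ∎
    where B = A (suc zero) ∷ A zero ∷ tail (tail A)

  ∷-isRowLinear : ∀ {Φ : (Fin (suc m) → Vector Carrier n) → Carrier} r →
                  IsRowLinear Φ → IsRowLinear (λ R → Φ (r ∷ R))
  ∷-isRowLinear r Φ-linear = record
    { cong   = λ R≋S → cong λ { zero _ → refl ; (suc i) → R≋S i }
    ; linear = λ i k Rᵢ R≈S R≈T → linear (suc i) k Rᵢ
        (λ { zero _ _ → refl ; (suc s) s≢i → R≈S s (s≢i ∘ ≡.cong suc) })
        (λ { zero _ _ → refl ; (suc s) s≢i → R≈T s (s≢i ∘ ≡.cong suc) })
    }
    where open IsRowLinear Φ-linear

  -- Rows are treated one at a time. Linearity in the current row leaves an extra term with `v`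
  -- itself as a row, which vanishes; the treated row is then frozen into the functional.
  shear-invariant : ∀ {Φ : (Fin m → Vector Carrier n) → Carrier} → IsRowLinear Φ →
                    ∀ (v : Vector Carrier n) → (∀ R i → (∀ l → R i l ≈ v l) → Φ R ≈ 0#) →
                    ∀ {R S} (k : Vector Carrier m) → (∀ i l → R i l ≈ S i l + k i * v l) → Φ R ≈ Φ S
  shear-invariant {zero}  Φ-linear v Φ-vanishes k e = IsRowLinear.cong Φ-linear λ ()
  shear-invariant {suc m} {Φ = Φ} Φ-linear v Φ-vanishes {R} {S} k e = begin
    Φ R ≈⟨ linear {R} {S zero ∷ tail R} {v ∷ tail R} zero (k zero) (e zero) (λ { zero z≢z → contradiction ≡.refl z≢z ; (suc r) _ _ → refl })
             (λ { zero z≢z → contradiction ≡.refl z≢z ; (suc r) _ _ → refl }) ⟩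
    Φ (S zero ∷ tail R) + k zero * Φ (v ∷ tail R) ≈⟨ +-congˡ (trans (*-congˡ (Φ-vanishes _ zero λ l → refl)) (zeroʳ _)) ⟩
    Φ (S zero ∷ tail R) + 0#                      ≈⟨ +-identityʳ _ ⟩
    Φ (S zero ∷ tail R) ≈⟨ shear-invariant (∷-isRowLinear (S zero) Φ-linear) v (λ R i → Φ-vanishes _ (suc i)) (tail k) (e ∘ suc) ⟩
    Φ (S zero ∷ tail S) ≈⟨ cong {S zero ∷ tail S} {S} (λ { zero _ → refl ; (suc i) _ → refl }) ⟩
    Φ S ∎
    where open IsRowLinear Φ-linear

  mutual

    det-zero-column : (A : SquareMatrix (suc n)) → (∀ i → A i zero ≈ 0#) → det A ≈ 0#
    det-zero-column A e = sum≈0 {t = term A} λ where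
      zero    → trans (*-congˡ (trans (*-congʳ (e zero)) (zeroˡ _))) (zeroʳ _)
      (suc j) → off-corner A (e ∘ suc) j

    -- Deleting a column `suc j` keeps column zero, so the minor again has a zero first column;
    -- hence the mutual recursion.
    off-corner : (A : SquareMatrix (suc n)) → (∀ i → A (suc i) zero ≈ 0#) → ∀ j → term A (suc j) ≈ 0#
    off-corner {suc n} A e j = trans (*-congˡ {sign (suc j)} (trans (*-congˡ (det-zero-column (minor A (suc j)) e)) (zeroʳ _))) (zeroʳ _)

  det-corner : (A : SquareMatrix (suc n)) → (∀ i → A (suc i) zero ≈ 0#) →
               det A ≈ A zero zero * det (minor A zero)
  det-corner A e = trans (sum-single {t = term A} zero λ where
    zero    0≢0 → contradiction ≡.refl 0≢0
    (suc j) _   → off-corner A e j) (*-identityˡ _)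

  -- The Schur complement of the entry (0 , 0), whose inverse is y.
  schur : Carrier → SquareMatrix (suc n) → SquareMatrix n
  schur y A i l = A (suc i) (suc l) + - (A (suc i) zero * y) * A zero (suc l)

  -- Subtracting `A (suc i) zero * y` times row zero from row `suc i` clears column zero below the
  -- corner and does not change the determinant. What then remains beside the corner is the Schur
  -- complement.
  det-schur : ∀ {y} (A : SquareMatrix (suc n)) → A zero zero * y ≈ 1# →
              det A ≈ A zero zero * det (schur y A)
  det-schur {n} {y} A e = begin
    det A            ≈⟨ det-cong {A = A} {A zero ∷ tail A} (λ { zero _ → refl ; (suc i) _ → refl }) ⟩
    det (A zero ∷ tail A)
      ≈⟨ shear-invariant (∷-isRowLinear (A zero) det-isRowLinear) (A zero) (λ R i → det-repeated-row (A zero ∷ R) i)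
           {R} {tail A} (λ i → - (A (suc i) zero * y)) (λ i l → refl) ⟨
    det (A zero ∷ R) ≈⟨ det-corner (A zero ∷ R) (λ i → begin
      A (suc i) zero + - (A (suc i) zero * y) * A zero zero
        ≈⟨ solve 3 (λ a y d → a :+ :- (a :* y) :* d := a :- a :* (d :* y)) refl (A (suc i) zero) y (A zero zero) ⟩
      A (suc i) zero - A (suc i) zero * (A zero zero * y) ≈⟨ +-congˡ (-‿cong (trans (*-congˡ e) (*-identityʳ _))) ⟩
      A (suc i) zero - A (suc i) zero                     ≈⟨ -‿inverseʳ _ ⟩
      0# ∎) ⟩
    A zero zero * det (schur y A) ∎
    where
    R : Fin n → Vector Carrier (suc n)
    R i l = A (suc i) l + - (A (suc i) zero * y) * A zero l

  -- P-matrices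

  -- One step of Gaussian elimination applied to `A z`: the multiple of row zero is chosen so that
  -- the contribution of `z zero` cancels.
  schur-·ᵥ : ∀ {y} (A : SquareMatrix (suc n)) → A zero zero * y ≈ 1# → ∀ z i →
             (schur y A ·ᵥ tail z) i ≈ (A ·ᵥ z) (suc i) + - (A (suc i) zero * y) * (A ·ᵥ z) zero
  schur-·ᵥ {y = y} A e z i = begin
    sum (λ l → (A (suc i) (suc l) + - k * A zero (suc l)) * z (suc l))
      ≈⟨ sum-cong-≋ (λ l → solve 4 (λ a k b z → (a :+ :- k :* b) :* z := a :* z :+ :- k :* (b :* z)) refl (A (suc i) (suc l)) k (A zero (suc l)) (z (suc l))) ⟩
    sum (λ l → A (suc i) (suc l) * z (suc l) + - k * (A zero (suc l) * z (suc l)))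
      ≈⟨ sum-linear (λ l → A (suc i) (suc l) * z (suc l)) (λ l → A zero (suc l) * z (suc l)) (- k) ⟩
    s + - k * t ≈⟨ solve 4 (λ p s k t → s :+ :- k :* t := (p :- p) :+ s :+ :- k :* t) refl (A (suc i) zero * z zero) s k t ⟩
    (A (suc i) zero * z zero - A (suc i) zero * z zero) + s + - k * t
      ≈⟨ +-congʳ (+-congʳ (+-congˡ (-‿cong (*-congʳ (sym (trans (*-congˡ e) (*-identityʳ _))))))) ⟩
    (A (suc i) zero * z zero - (A (suc i) zero * (A zero zero * y)) * z zero) + s + - k * t
      ≈⟨ solve 6 (λ b z a y s t → (b :* z :- (b :* (a :* y)) :* z) :+ s :+ :- (b :* y) :* t := (b :* z :+ s) :+ :- (b :* y) :* (a :* z :+ t)) refl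
           (A (suc i) zero) (z zero) (A zero zero) y s t ⟩
    (A ·ᵥ z) (suc i) + - k * (A ·ᵥ z) zero ∎
    where
    k = A (suc i) zero * y
    s = sum λ l → A (suc i) (suc l) * z (suc l)
    t = sum λ l → A zero (suc l) * z (suc l)

  IsPMatrix-corner : {A : SquareMatrix (suc n)} → IsPMatrix A → 0# < A zero zero
  IsPMatrix-corner {A = A} P = 0<-resp-≈ (trans (+-identityʳ _) (trans (*-identityˡ _) (*-identityʳ _)))
    (P {1} (λ _ → zero) λ { {zero} {zero} () })

  IsPMatrix-tail : {A : SquareMatrix (suc n)} → IsPMatrix A → IsPMatrix (λ i → tail (A (suc i)))
  IsPMatrix-tail P f f-mono = P (suc ∘ f) (ℕ.s≤s ∘ f-mono)

  -- A principal minor of the complement, times the corner entry, is the principal minor of `A` with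
  -- index zero added, which is what `Fin.lift 1 f` enumerates.
  IsPMatrix-schur : ∀ {A : SquareMatrix (suc n)} {y} → A zero zero * y ≈ 1# → IsPMatrix A → IsPMatrix (schur y A)
  IsPMatrix-schur {A = A} e P f f-mono = 0<-cancelˡ-* (IsPMatrix-corner {A = A} P)
    (0<-resp-≈ (det-schur (λ i j → A (Fin.lift 1 f i) (Fin.lift 1 f j)) e) (P (Fin.lift 1 f) (λ {i} {j} → lift-mono {i} {j})))
    where
    lift-mono : ∀ {i j} → i Fin.< j → Fin.lift 1 f i Fin.< Fin.lift 1 f j
    lift-mono {zero}  {suc j} _         = ℕ.s≤s ℕ.z≤n
    lift-mono {suc i} {suc j} (ℕ.s≤s p) = ℕ.s≤s (f-mono p)

  raise : Carrier → SquareMatrix (suc n) → SquareMatrix (suc n)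
  raise t A zero    zero    = A zero zero + t
  raise t A zero    (suc j) = A zero (suc j)
  raise t A (suc i) j       = A (suc i) j

  det-raise : ∀ t (A : SquareMatrix (suc n)) → det (raise t A) ≈ det A + t * det (minor A zero)
  det-raise {n} t A = begin
    1# * ((A zero zero + t) * d) + r
      ≈⟨ solve 5 (λ o a t d r → o :* ((a :+ t) :* d) :+ r := (o :* (a :* d) :+ r) :+ t :* (o :* d)) refl 1# (A zero zero) t d r ⟩
    det A + t * (1# * d) ≈⟨ +-congˡ (*-congˡ (*-identityˡ d)) ⟩
    det A + t * d ∎
    where
    d = det (minor A zero)
    r = sum {n} λ j → term A (suc j)

  -- An increasing enumeration can meet index zero only in its first place. If it does, raising adds
  -- `t` times the principal minor of the other indices; if not, the submatrix is unchanged.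
  IsPMatrix-raise : ∀ {A : SquareMatrix (suc n)} {t} → 0# ≤ t → IsPMatrix A → IsPMatrix (raise t A)
  IsPMatrix-raise                 0≤t P {zero}  f f-mono = 0<1
  IsPMatrix-raise {A = A} {t} 0≤t P {suc k} f f-mono with f zero Fin.≟ zero
  ... | no f₀≢0 = 0<-resp-≈ (det-cong {A = λ i j → A (f i) (f j)} {λ i j → raise t A (f i) (f j)}
      λ i j → reflexive (≡.sym (raise-row (f i) (f j) (f≢0 i)))) (P f f-mono)
    where
    raise-row : ∀ i j → i ≢ zero → raise t A i j ≡ A i j
    raise-row zero    j i≢0 = contradiction ≡.refl i≢0
    raise-row (suc i) j i≢0 = ≡.refl
    f≢0 : ∀ i → f i ≢ zero
    f≢0 zero    = f₀≢0
    f≢0 (suc i) e = case ≡.subst (f zero Fin.<_) e (f-mono {zero} {suc i} (ℕ.s≤s ℕ.z≤n)) of λ ()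
  ... | yes f₀≡0 = 0<-resp-≈ (sym (begin
      det (λ i j → raise t A (f i) (f j))  ≈⟨ det-cong raise-sub ⟩
      det (raise t B)                      ≈⟨ det-raise t B ⟩
      det B + t * det (minor B zero)       ∎))
      (0<x∧0≤y⇒0<x+y (P f f-mono) (0≤x∧0≤y⇒0≤x*y 0≤t (inj₁ (P (f ∘ suc) (f-mono ∘ ℕ.s≤s)))))
    where
    B : SquareMatrix (suc k)
    B i j = A (f i) (f j)
    fₛ≢0 : ∀ i → f (suc i) ≢ zero
    fₛ≢0 i e = case ≡.subst (f zero Fin.<_) e (f-mono {zero} {suc i} (ℕ.s≤s ℕ.z≤n)) of λ ()
    raise-off : ∀ i j → i ≢ zero ⊎ j ≢ zero → raise t A i j ≡ A i j
    raise-off zero    zero    (inj₁ e) = contradiction ≡.refl e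
    raise-off zero    zero    (inj₂ e) = contradiction ≡.refl e
    raise-off zero    (suc j) _        = ≡.refl
    raise-off (suc i) j       _        = ≡.refl
    raise-sub : (λ i j → raise t A (f i) (f j)) ≋ raise t B
    raise-sub zero    zero    rewrite f₀≡0 = refl
    raise-sub zero    (suc j) = reflexive (raise-off (f zero) (f (suc j)) (inj₂ (fₛ≢0 j)))
    raise-sub (suc i) j       = reflexive (raise-off (f (suc i)) (f j) (inj₁ (fₛ≢0 i)))

  -- If x₀ ≠ 0, raising the corner entry by −(Ax)₀ / x₀ ≥ 0 keeps A a P-matrix
  -- and makes (Ax)₀ vanish, so that the Schur complement inherits the hypothesis.
  P-matrix-reverses-no-sign : {A : SquareMatrix n} → IsPMatrix A → ∀ x →
                              (∀ i → x i * (A ·ᵥ x) i ≤ 0#) → ∀ i → x i ≈ 0#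
  P-matrix-reverses-no-sign {suc n} {A} P x rev with x zero ≟0
  ... | yes x₀≈0 = λ { zero → x₀≈0 ; (suc i) →
      P-matrix-reverses-no-sign {A = λ i → tail (A (suc i))} (IsPMatrix-tail {A = A} P) (tail x)
        (λ i → ≤0-resp-≈ (*-congˡ (·ᵥ-tail i)) (rev (suc i))) i }
    where
    ·ᵥ-tail : ∀ i → (A ·ᵥ x) (suc i) ≈ ((λ i → tail (A (suc i))) ·ᵥ tail x) i
    ·ᵥ-tail i = trans (+-congʳ (trans (*-congˡ x₀≈0) (zeroʳ _))) (+-identityˡ _)
  -- By induction the tail of `x` vanishes, so the zeroth entry of `A⁺ x`, which is zero by the
  -- choice of `t`, reduces to `a * x zero`.
  ... | no x₀≉0 = contradiction (x*y≈0⇒y≈0 a≉0 (begin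
      a * x zero     ≈⟨ +-identityʳ _ ⟨
      a * x zero + 0# ≈⟨ +-congˡ (sum≈0 {t = λ l → A zero (suc l) * x (suc l)} λ l → trans (*-congˡ (x≈0 l)) (zeroʳ _)) ⟨
      (A⁺ ·ᵥ x) zero ≈⟨ A⁺x₀≈0 ⟩
      0#             ∎)) x₀≉0
    where
    w u t a y : Carrier
    w = (A ·ᵥ x) zero
    u = proj₁ (inverse (x zero) x₀≉0)
    t = - w * u

    x₀u≈1 : x zero * u ≈ 1#
    x₀u≈1 = proj₂ (inverse (x zero) x₀≉0)

    0≤t : 0# ≤ t
    -- Writing `t` as `- (x zero * w)` times a square makes it a product of nonnegative factors,
    -- with no case distinction on the sign of `x zero`.
    0≤t = 0≤-resp-≈ (begin
      - (x zero * w) * (u * u) ≈⟨ solve 3 (λ x w u → :- (x :* w) :* (u :* u) := (x :* u) :* (:- w :* u)) refl (x zero) w u ⟩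
      (x zero * u) * t         ≈⟨ *-congʳ x₀u≈1 ⟩
      1# * t                   ≈⟨ *-identityˡ t ⟩
      t                        ∎)
      (0≤x∧0≤y⇒0≤x*y (x≤0⇒0≤-x (rev zero)) (0≤x*x u))

    A⁺ : SquareMatrix (suc n)
    A⁺ = raise t A

    P⁺ : IsPMatrix A⁺
    P⁺ = IsPMatrix-raise {A = A} 0≤t P

    a = A⁺ zero zero

    a≉0 : ¬ a ≈ 0#
    a≉0 a≈0 = <.irrefl (sym a≈0) (IsPMatrix-corner {A = A⁺} P⁺)

    y = proj₁ (inverse a a≉0)

    A⁺x₀≈0 : (A⁺ ·ᵥ x) zero ≈ 0#
    A⁺x₀≈0 = begin
      (A zero zero + - w * u) * x zero + s
        ≈⟨ solve 5 (λ a w u x s → (a :+ :- w :* u) :* x :+ s := (a :* x :+ s) :- w :* (x :* u)) refl (A zero zero) w u (x zero) s ⟩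
      w - w * (x zero * u) ≈⟨ +-congˡ (-‿cong (trans (*-congˡ x₀u≈1) (*-identityʳ w))) ⟩
      w - w                ≈⟨ -‿inverseʳ w ⟩
      0#                   ∎
      where s = sum λ l → A zero (suc l) * x (suc l)

    x≈0 : ∀ l → x (suc l) ≈ 0#
    x≈0 = P-matrix-reverses-no-sign {A = schur y A⁺} (IsPMatrix-schur {A = A⁺} (proj₂ (inverse a a≉0)) P⁺) (tail x) λ i →
      ≤0-resp-≈ (*-congˡ (sym (begin
        (schur y A⁺ ·ᵥ tail x) i ≈⟨ schur-·ᵥ A⁺ (proj₂ (inverse a a≉0)) x i ⟩
        (A ·ᵥ x) (suc i) + - (A (suc i) zero * y) * (A⁺ ·ᵥ x) zero ≈⟨ +-congˡ (trans (*-congˡ A⁺x₀≈0) (zeroʳ _)) ⟩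
        (A ·ᵥ x) (suc i) + 0# ≈⟨ +-identityʳ _ ⟩
        (A ·ᵥ x) (suc i) ∎))) (rev (suc i))

  -- Semipositive Z-matrices

  𝟙 : SquareMatrix n
  𝟙 i j = if does (i Fin.≟ j) then 1# else 0#

  𝟙-diagonal : (i : Fin n) → 𝟙 i i ≈ 1#
  𝟙-diagonal i with i Fin.≟ i
  ... | yes _  = refl
  ... | no i≢i = contradiction ≡.refl i≢i

  𝟙-off-diagonal : {i j : Fin n} → i ≢ j → 𝟙 i j ≈ 0#
  𝟙-off-diagonal {i = i} {j} i≢j with i Fin.≟ j
  ... | yes i≡j = contradiction i≡j i≢j
  ... | no _    = refl

  0≤𝟙 : (i j : Fin n) → 0# ≤ 𝟙 i j
  0≤𝟙 i j with i Fin.≟ j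
  ... | yes _ = inj₁ 0<1
  ... | no _  = inj₂ refl

  sum-𝟙ˡ : (i : Fin n) (t : Vector Carrier n) → sum (λ k → 𝟙 i k * t k) ≈ t i
  sum-𝟙ˡ i t = trans (sum-single {t = λ k → 𝟙 i k * t k} i λ k k≢i → trans (*-congʳ (𝟙-off-diagonal (k≢i ∘ ≡.sym))) (zeroˡ _))
                     (trans (*-congʳ (𝟙-diagonal i)) (*-identityˡ _))

  sum-𝟙ʳ : (i : Fin n) (t : Vector Carrier n) → sum (λ k → t k * 𝟙 k i) ≈ t i
  sum-𝟙ʳ i t = trans (sum-single {t = λ k → t k * 𝟙 k i} i λ k k≢i → trans (*-congˡ (𝟙-off-diagonal k≢i)) (zeroʳ _))
                     (trans (*-congˡ (𝟙-diagonal i)) (*-identityʳ _))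

  sum-assoc : (t : Vector Carrier m) (B : Fin m → Vector Carrier n) (x : Vector Carrier n) →
              sum (λ k → t k * sum λ l → B k l * x l) ≈ sum λ l → (sum λ k → t k * B k l) * x l
  sum-assoc t B x = begin
    sum (λ k → t k * sum λ l → B k l * x l)
      ≈⟨ sum-cong-≋ (λ k → trans (*-distribˡ-sum (t k) (λ l → B k l * x l)) (sum-cong-≋ λ l → sym (*-assoc (t k) (B k l) (x l)))) ⟩
    sum (λ k → sum λ l → t k * B k l * x l) ≈⟨ ∑-comm (λ k l → t k * B k l * x l) ⟩
    sum (λ l → sum λ k → t k * B k l * x l) ≈⟨ sum-cong-≋ (λ l → *-distribʳ-sum (x l) (λ k → t k * B k l)) ⟨
    sum (λ l → (sum λ k → t k * B k l) * x l) ∎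

  Semipositive : SquareMatrix n → Set (c ⊔ ℓ₁ ⊔ ℓ₂)
  Semipositive A = ∃ λ x → (∀ j → 0# ≤ x j) × (∀ i → 0# < (A ·ᵥ x) i)

  module _ (A : SquareMatrix (suc n)) (Z : IsZMatrix A) where

    0≤-offdiagonal : ∀ (x : Vector Carrier (suc n)) → (∀ j → 0# ≤ x (suc j)) → 0# ≤ - sum λ l → A zero (suc l) * x (suc l)
    0≤-offdiagonal x x≥0 = 0≤-resp-≈ (sym (sum-neg λ l → A zero (suc l) * x (suc l)))
      (sum-nonneg λ l → x≤0∧0≤y⇒0≤-x*y (Z zero (suc l) λ ()) (x≥0 l))

    -- The off-diagonal terms of the zeroth entry of `A x` are nonpositive, so the positivity must
    -- come from `A zero zero * x zero`, where `x zero ≥ 0`.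
    semipositive-corner : Semipositive A → 0# < A zero zero
    semipositive-corner (x , x≥0 , Ax>0) = 0<-cancelʳ-* (x≥0 zero)
      (0<-resp-≈ (solve 2 (λ p s → (p :+ s) :- s := p) refl (A zero zero * x zero) (sum λ l → A zero (suc l) * x (suc l)))
        (0<x∧0≤y⇒0<x+y (Ax>0 zero) (0≤-offdiagonal x (x≥0 ∘ suc))))

    module _ {y} (e : A zero zero * y ≈ 1#) (y>0 : 0# < y) where

      0≤-multiplier : ∀ i → 0# ≤ - (A (suc i) zero * y)
      0≤-multiplier i = x≤0∧0≤y⇒0≤-x*y (Z (suc i) zero λ ()) (inj₁ y>0)

      schur-isZ : IsZMatrix (schur y A)
      schur-isZ i j i≢j = 0≤-x⇒x≤0 (0≤-resp-≈
        (solve 3 (λ a k b → :- a :+ k :* :- b := :- (a :+ k :* b)) refl (A (suc i) (suc j)) (- (A (suc i) zero * y)) (A zero (suc j)))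
        (0≤x∧0≤y⇒0≤x+y (x≤0⇒0≤-x (Z (suc i) (suc j) (i≢j ∘ Fin.suc-injective)))
                        (0≤x∧0≤y⇒0≤x*y (0≤-multiplier i) (x≤0⇒0≤-x (Z zero (suc j) λ ())))))

      -- The old vector without its zeroth entry still works: elimination adds a nonnegative
      -- multiple of a positive entry to each remaining entry of `A x`.
      schur-semipositive : Semipositive A → Semipositive (schur y A)
      schur-semipositive (x , x≥0 , Ax>0) = tail x , x≥0 ∘ suc , λ i → 0<-resp-≈ (sym (schur-·ᵥ A e x i))
        (0<x∧0≤y⇒0<x+y (Ax>0 (suc i)) (0≤x∧0≤y⇒0≤x*y (0≤-multiplier i) (inj₁ (Ax>0 zero))))

  module _ (A : SquareMatrix (suc n)) (Z : IsZMatrix A) (S : Semipositive A) where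

    corner⁻¹ : Carrier
    corner⁻¹ = proj₁ (positive-inverse (semipositive-corner A Z S))

    corner⁻¹-inverse : A zero zero * corner⁻¹ ≈ 1#
    corner⁻¹-inverse = proj₁ (proj₂ (positive-inverse (semipositive-corner A Z S)))

    corner⁻¹>0 : 0# < corner⁻¹
    corner⁻¹>0 = proj₂ (proj₂ (positive-inverse (semipositive-corner A Z S)))

    complement : SquareMatrix n
    complement = schur corner⁻¹ A

    complement-isZ : IsZMatrix complement
    complement-isZ = schur-isZ A Z corner⁻¹-inverse corner⁻¹>0

    complement-semipositive : Semipositive complement
    complement-semipositive = schur-semipositive A Z corner⁻¹-inverse corner⁻¹>0 S

  det-semipositive : (A : SquareMatrix n) → IsZMatrix A → Semipositive A → 0# < det A
  det-semipositive {zero}  A Z S = 0<1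
  det-semipositive {suc n} A Z S = 0<-resp-≈ (sym (det-schur A (corner⁻¹-inverse A Z S)))
    (*-pos (semipositive-corner A Z S) (det-semipositive (complement A Z S) (complement-isZ A Z S) (complement-semipositive A Z S)))

  -- Elimination adds nonnegative multiples of `(A z) zero`, so the hypothesis passes to the
  -- complement and the tail of `z` is nonnegative. Back-substitution in row zero, whose
  -- off-diagonal entries are nonpositive, then gives `z zero`.
  monotone : (A : SquareMatrix n) → IsZMatrix A → Semipositive A →
             ∀ (z : Vector Carrier n) → (∀ i → 0# ≤ (A ·ᵥ z) i) → ∀ i → 0# ≤ z i
  monotone {suc n} A Z S z Az≥0 = λ { zero → z₀≥0 ; (suc i) → z≥0 i }
    where
    z≥0 : ∀ i → 0# ≤ z (suc i)
    z≥0 = monotone (complement A Z S) (complement-isZ A Z S) (complement-semipositive A Z S) (tail z) λ i →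
      0≤-resp-≈ (sym (schur-·ᵥ A (corner⁻¹-inverse A Z S) z i))
        (0≤x∧0≤y⇒0≤x+y (Az≥0 (suc i)) (0≤x∧0≤y⇒0≤x*y (0≤-multiplier A Z (corner⁻¹-inverse A Z S) (corner⁻¹>0 A Z S) i) (Az≥0 zero)))
    z₀≥0 : 0# ≤ z zero
    z₀≥0 = 0≤-cancelˡ-* (semipositive-corner A Z S)
      (0≤-resp-≈ (solve 2 (λ p s → (p :+ s) :- s := p) refl (A zero zero * z zero) (sum λ l → A zero (suc l) * z (suc l)))
        (0≤x∧0≤y⇒0≤x+y (Az≥0 zero) (0≤-offdiagonal A Z z z≥0)))

  solvable : (A : SquareMatrix n) → IsZMatrix A → Semipositive A → ∀ (r : Vector Carrier n) → ∃ λ z → ∀ i → (A ·ᵥ z) i ≈ r i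
  solvable {zero}  A Z S r = [] , λ ()
  solvable {suc n} A Z S r = z , λ { zero → row₀ ; (suc i) → row i }
    where
    y = corner⁻¹ A Z S
    r′ : Vector Carrier n
    r′ i = r (suc i) + - (A (suc i) zero * y) * r zero
    tail-solution = solvable (complement A Z S) (complement-isZ A Z S) (complement-semipositive A Z S) r′
    z′ = proj₁ tail-solution
    s = sum λ l → A zero (suc l) * z′ l
    -- Back-substitution: with the tail known, row zero determines the remaining unknown, and `y`
    -- inverts its coefficient.
    z = y * (r zero - s) ∷ z′
    row₀ : (A ·ᵥ z) zero ≈ r zero
    row₀ = begin
      A zero zero * (y * (r zero - s)) + s ≈⟨ +-congʳ (trans (sym (*-assoc _ _ _)) (trans (*-congʳ (corner⁻¹-inverse A Z S)) (*-identityˡ _))) ⟩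
      (r zero - s) + s                     ≈⟨ solve 2 (λ r s → (r :- s) :+ s := r) refl (r zero) s ⟩
      r zero                               ∎
    row : ∀ i → (A ·ᵥ z) (suc i) ≈ r (suc i)
    row i = begin
      (A ·ᵥ z) (suc i) ≈⟨ solve 2 (λ p q → p := (p :+ q) :- q) refl ((A ·ᵥ z) (suc i)) (- (A (suc i) zero * y) * (A ·ᵥ z) zero) ⟩
      ((A ·ᵥ z) (suc i) + - (A (suc i) zero * y) * (A ·ᵥ z) zero) - - (A (suc i) zero * y) * (A ·ᵥ z) zero
        ≈⟨ +-cong (trans (sym (schur-·ᵥ A (corner⁻¹-inverse A Z S) z i)) (proj₂ tail-solution i)) (-‿cong (*-congˡ row₀)) ⟩
      r′ i - - (A (suc i) zero * y) * r zero ≈⟨ solve 2 (λ p q → (p :+ q) :- q := p) refl (r (suc i)) (- (A (suc i) zero * y) * r zero) ⟩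
      r (suc i) ∎

  ·ᵥ-sub : {R : Set} (A : R → Vector Carrier n) → ∀ x y i → (A ·ᵥ (λ k → x k - y k)) i ≈ (A ·ᵥ x) i - (A ·ᵥ y) i
  ·ᵥ-sub A x y i = begin
    sum (λ k → A i k * (x k - y k))
      ≈⟨ sum-cong-≋ (λ k → trans (distribˡ (A i k) (x k) (- y k)) (+-congˡ (solve 2 (λ a y → a :* :- y := :- (a :* y)) refl (A i k) (y k)))) ⟩
    sum (λ k → A i k * x k - A i k * y k) ≈⟨ ∑-distrib-+ (λ k → A i k * x k) (λ k → - (A i k * y k)) ⟩
    (A ·ᵥ x) i + sum (λ k → - (A i k * y k)) ≈⟨ +-congˡ (sum-neg λ k → A i k * y k) ⟨
    (A ·ᵥ x) i - (A ·ᵥ y) i ∎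

  -- Monotonicity applies to `x - y` and to `y - x`, since both are mapped to zero.
  injective : (A : SquareMatrix n) → IsZMatrix A → Semipositive A →
              ∀ (x y : Vector Carrier n) → (∀ i → (A ·ᵥ x) i ≈ (A ·ᵥ y) i) → ∀ i → x i ≈ y i
  injective A Z S x y Ax≈Ay i = begin
    x i               ≈⟨ solve 2 (λ x y → x := (x :- y) :+ y) refl (x i) (y i) ⟩
    (x i - y i) + y i ≈⟨ +-congʳ (0≤-antisym (nonneg x y Ax≈Ay i)
                           (0≤-resp-≈ (solve 2 (λ x y → y :- x := :- (x :- y)) refl (x i) (y i)) (nonneg y x (sym ∘ Ax≈Ay) i))) ⟩
    0# + y i          ≈⟨ +-identityˡ (y i) ⟩
    y i               ∎
    where
    nonneg : ∀ x y → (∀ i → (A ·ᵥ x) i ≈ (A ·ᵥ y) i) → ∀ i → 0# ≤ x i - y i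
    nonneg x y Ax≈Ay = monotone A Z S (λ k → x k - y k) λ i →
      inj₂ (sym (trans (·ᵥ-sub A x y i) (trans (+-congʳ (Ax≈Ay i)) (-‿inverseʳ _))))

  record NonnegativeInverse (A : SquareMatrix n) : Set (c ⊔ ℓ₁ ⊔ ℓ₂) where
    field
      A⁻¹      : SquareMatrix n
      A⁻¹≥0    : ∀ i j → 0# ≤ A⁻¹ i j
      inverseʳ : ∀ i j → (sum λ k → A i k * A⁻¹ k j) ≈ 𝟙 i j
      inverseˡ : ∀ i j → (sum λ k → A⁻¹ i k * A k j) ≈ 𝟙 i j

  -- Column `j` solves the system with the unit vector `j` on the right, so monotonicity makes it
  -- nonnegative. That it is also a left inverse follows by cancelling `A` in `A (B A) = A = A 𝟙`.
  nonnegativeInverse : (A : SquareMatrix n) → IsZMatrix A → Semipositive A → NonnegativeInverse A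
  nonnegativeInverse A Z S = record
    { A⁻¹      = B
    ; A⁻¹≥0    = λ i j → monotone A Z S (λ k → B k j) (λ l → 0≤-resp-≈ (sym (AB≈𝟙 l j)) (0≤𝟙 l j)) i
    ; inverseʳ = AB≈𝟙
    ; inverseˡ = λ i j → injective A Z S (λ i → sum λ k → B i k * A k j) (λ i → 𝟙 i j) (λ l → begin
        sum (λ i → A l i * sum λ k → B i k * A k j)   ≈⟨ sum-assoc (A l) B (λ k → A k j) ⟩
        sum (λ k → (sum λ i → A l i * B i k) * A k j) ≈⟨ sum-cong-≋ (λ k → *-congʳ {A k j} (AB≈𝟙 l k)) ⟩
        sum (λ k → 𝟙 l k * A k j)                     ≈⟨ sum-𝟙ˡ l (λ k → A k j) ⟩
        A l j                                         ≈⟨ sum-𝟙ʳ j (A l) ⟨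
        sum (λ i → A l i * 𝟙 i j)                     ∎) i
    }
    where
    B : SquareMatrix _
    B i j = proj₁ (solvable A Z S (λ l → 𝟙 l j)) i
    AB≈𝟙 : ∀ l j → (sum λ i → A l i * B i j) ≈ 𝟙 l j
    AB≈𝟙 l j = proj₂ (solvable A Z S (λ l → 𝟙 l j)) l

  -- The vector is `A⁻¹` applied to the all-ones vector, where `A⁻¹` is the transposed inverse of
  -- the transpose; its image under `A` is the all-ones vector. This converts a condition on column
  -- sums, the form in which the hidden Z-witness supplies it, into one on rows.
  semipositive-transpose : (A : SquareMatrix n) → IsZMatrix A → Semipositive (λ i j → A j i) → Semipositive A
  semipositive-transpose {n} A Z S = (λ k → sum (B k)) , (λ k → sum-nonneg λ i → A⁻¹≥0 i k) , λ l → 0<-resp-≈ (sym (begin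
    sum (λ k → A l k * sum (B k)) ≈⟨ sum-cong-≋ (λ k → *-congˡ {A l k} (sum-cong-≋ λ i → sym (*-identityʳ (B k i)))) ⟩
    sum (λ k → A l k * sum λ i → B k i * 1#) ≈⟨ sum-assoc (A l) B (λ _ → 1#) ⟩
    sum (λ i → (sum λ k → A l k * B k i) * 1#)
      ≈⟨ sum-cong-≋ (λ i → *-congʳ {1#} (trans (sum-cong-≋ λ k → *-comm (A l k) (B k i)) (inverseˡ i l))) ⟩
    sum (λ i → 𝟙 i l * 1#) ≈⟨ sum-cong-≋ (λ i → *-comm (𝟙 i l) 1#) ⟩
    sum (λ i → 1# * 𝟙 i l) ≈⟨ sum-𝟙ʳ l (λ _ → 1#) ⟩
    1# ∎)) 0<1
    where
    open NonnegativeInverse (nonnegativeInverse (λ i j → A j i) (λ i j i≢j → Z j i (i≢j ∘ ≡.sym)) S)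
    B : SquareMatrix n
    B k i = A⁻¹ i k

  -- Passing to the image of `f` discards only nonpositive terms. The induction overwrites the value
  -- at `f zero` by zero in `t′`, so that `f` loses an index while the range stays `Fin n`.
  sum-injection : (f : Fin m → Fin n) → (∀ {i j} → f i ≡ f j → i ≡ j) → (t : Vector Carrier n) →
                  (∀ l → (∀ i → f i ≢ l) → t l ≤ 0#) → 0# ≤ sum (t ∘ f) - sum t
  sum-injection {zero} f f-inj t t≤0 = 0≤-resp-≈ (sym (trans (+-identityˡ _) (sum-neg t))) (sum-nonneg λ l → x≤0⇒0≤-x (t≤0 l λ ()))
  sum-injection {suc m} {n} f f-inj t t≤0 = 0≤-resp-≈ (begin
    sum (t′ ∘ f ∘ suc) - sum t′ ≈⟨ solve 3 (λ p x y → x :- y := (p :+ x) :- (p :+ y)) refl (t a) (sum (t′ ∘ f ∘ suc)) (sum t′) ⟩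
    (t a + sum (t′ ∘ f ∘ suc)) - (t a + sum t′) ≈⟨ +-cong (+-congˡ (sum-cong-≋ λ i → t′-off {f (suc i)} λ e → case f-inj e of λ ())) (-‿cong (sym sum-t)) ⟩
    sum (t ∘ f) - sum t ∎)
    (sum-injection (f ∘ suc) (λ e → Fin.suc-injective (f-inj e)) t′ t′≤0)
    where
    a = f zero
    s t′ : Vector Carrier n
    s l = if does (l Fin.≟ a) then t l else 0#
    t′ l = if does (l Fin.≟ a) then 0# else t l
    t′-off : ∀ {l} → l ≢ a → t′ l ≈ t l
    t′-off {l} l≢a with l Fin.≟ a
    ... | yes l≡a = contradiction l≡a l≢a
    ... | no _    = refl
    t′≤0 : ∀ l → (∀ i → f (suc i) ≢ l) → t′ l ≤ 0#
    t′≤0 l l∉ with l Fin.≟ a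
    ... | yes _  = inj₂ refl
    ... | no l≢a = t≤0 l λ { zero e → l≢a (≡.sym e) ; (suc i) → l∉ i }
    s-single : ∀ l → l ≢ a → s l ≈ 0#
    s-single l l≢a with l Fin.≟ a
    ... | yes l≡a = contradiction l≡a l≢a
    ... | no _    = refl
    s-a : s a ≈ t a
    s-a with a Fin.≟ a
    ... | yes _  = refl
    ... | no a≢a = contradiction ≡.refl a≢a
    split : ∀ l → t l ≈ s l + t′ l
    split l with l Fin.≟ a
    ... | yes _ = sym (+-identityʳ _)
    ... | no _  = sym (+-identityˡ _)
    sum-t : sum t ≈ t a + sum t′
    sum-t = trans (sum-cong-≋ split) (trans (∑-distrib-+ s t′) (+-congʳ (trans (sum-single a s-single) s-a)))

  -- In a row `f i`, the discarded columns are off-diagonal and contribute nonpositive terms, so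
  -- restricting `x` can only increase the entries of `A x`.
  semipositive-principal : ∀ (A : SquareMatrix n) (f : Fin m → Fin n) → (∀ {i j} → f i ≡ f j → i ≡ j) →
                           IsZMatrix A → Semipositive A → Semipositive (λ i j → A (f i) (f j))
  semipositive-principal A f f-inj Z (x , x≥0 , Ax>0) = x ∘ f , x≥0 ∘ f , λ i →
    0<-resp-≈ (solve 2 (λ p q → p :+ (q :- p) := q) refl ((A ·ᵥ x) (f i)) (sum λ k → A (f i) (f k) * x (f k)))
      (0<x∧0≤y⇒0<x+y (Ax>0 (f i)) (sum-injection f f-inj (λ l → A (f i) l * x l) λ l l∉ →
        0≤-x⇒x≤0 (x≤0∧0≤y⇒0≤-x*y (Z (f i) l (l∉ i)) (x≥0 l))))

  mono⇒injective : (f : Fin m → Fin n) → (∀ {i j} → i Fin.< j → f i Fin.< f j) → ∀ {i j} → f i ≡ f j → i ≡ j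
  mono⇒injective f f-mono {i} {j} e with Fin.<-cmp i j
  ... | tri< p _ _ = contradiction e (Fin.<⇒≢ (f-mono p))
  ... | tri≈ _ p _ = p
  ... | tri> _ _ p = contradiction (≡.sym e) (Fin.<⇒≢ (f-mono p))

  semipositive⇒P : (A : SquareMatrix n) → IsZMatrix A → Semipositive A → IsPMatrix A
  semipositive⇒P A Z S f f-mono = det-semipositive (λ i j → A (f i) (f j))
    (λ i j i≢j → Z (f i) (f j) (i≢j ∘ mono⇒injective f f-mono))
    (semipositive-principal A f (mono⇒injective f f-mono) Z S)

  -- Block matrices and hidden K-witnesses

  ι-injective : {p p′ : Idx b} → ι p ≡ ι p′ → p ≡ p′
  ι-injective {p = j , i} {p′ = j′ , i′} e with ≡.cong proj₁ e
  ... | ≡.refl = ≡.cong (j ,_) (Fin.↑ˡ-injective 1 i i′ (Product.,-injectiveʳ e))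

  ι≢new : (p : Idx b) → ∀ {j} → ι p ≢ new b j
  ι≢new {b = b} (j , i) e with ≡.cong proj₁ e
  ... | ≡.refl = case ≡.trans (≡.sym (Fin.splitAt-↑ˡ (b j) i 1))
                  (≡.trans (≡.cong (Fin.splitAt (b j)) (Product.,-injectiveʳ e)) (Fin.splitAt-↑ʳ (b j) 1 zero)) of λ ()

  -- Matching on a view puts an index into one of the two forms to which `[∣]-ι` and `[∣]-new`
  -- apply.
  data View {n} (b : Vector ℕ n) : Idx (b +𝟏) → Set where
    old  : (p : Idx b) → View b (ι p)
    last : (j : Fin n) → View b (new b j)

  view : (p : Idx (b +𝟏)) → View b p
  view {b = b} (j , k) with Fin.splitAt (b j) k in e
  ... | inj₁ i    = ≡.subst (λ k → View b (j , k)) (Fin.splitAt⁻¹-↑ˡ e) (old (j , i))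
  ... | inj₂ zero = ≡.subst (λ k → View b (j , k)) (Fin.splitAt⁻¹-↑ʳ {m = b j} e) (last j)

  [∣]-ι : (v : Idx b → A) (x : Vector A n) (p : Idx b) → [ v ∣ x ] (ι p) ≡ v p
  [∣]-ι v x (j , i) = lookup-++ˡ (λ k → v (j , k)) (x j ∷ []) i

  [∣]-new : (v : Idx b → A) (x : Vector A n) (j : Fin n) → [ v ∣ x ] (new b j) ≡ x j
  [∣]-new v x j = lookup-++ʳ (λ k → v (j , k)) (x j ∷ []) zero

  sum-last : (t : Vector Carrier (m ℕ.+ 1)) → sum t ≈ sum (λ i → t (i ↑ˡ 1)) + t (m ↑ʳ zero)
  sum-last {zero}  t = +-comm _ _
  sum-last {suc m} t = trans (+-congˡ (sum-last (tail t))) (sym (+-assoc _ _ _))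

  Selects : {b : Vector ℕ n} → (∀ j → Fin (b j)) → Pred (Idx b) 0ℓ
  Selects σ (j , i) = σ j ≡ i

  selects-complementary : (σ : ∀ j → Fin (b j)) → MaximalComplementary (Selects {b = b} σ)
  selects-complementary σ j = σ j , ≡.refl , id

  inhabitant : ∀ m → .{{NonZero m}} → Fin m
  inhabitant (suc m) = zero

  selection-through : {b : Vector ℕ n} → (∀ j → NonZero (b j)) → (p : Idx b) → ∃ λ (σ : ∀ j → Fin (b j)) → σ (proj₁ p) ≡ proj₂ p
  selection-through {b = b} b≢0 (j , i) = σ , σj≡i
    where
    σ : ∀ l → Fin (b l)
    σ l with j Fin.≟ l
    ... | yes ≡.refl = i
    ... | no _       = inhabitant (b l) {{b≢0 l}}
    σj≡i : σ j ≡ i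
    σj≡i with j Fin.≟ j
    ... | yes ≡.refl = ≡.refl
    ... | no j≢j     = contradiction ≡.refl j≢j

  -- The block Z-property speaks of whole representatives only, so the row is completed to one; this
  -- requires every other block to be nonempty.
  block-Z-row : {b : Vector ℕ n} {M : BlockMatrix b} → (∀ j → NonZero (b j)) → IsBlockZMatrix M →
                ∀ p l → l ≢ proj₁ p → M p l ≤ 0#
  block-Z-row {M = M} b≢0 Z p@(j , i) l l≢j with selection-through b≢0 p
  ... | σ , ≡.refl = Z (selects-complementary σ) j l (l≢j ∘ ≡.sym)

  dot : Vector Carrier n → Vector Carrier n → Carrier
  dot h v = sum λ c → h c * v c

  dot-neg : ∀ (h v : Vector Carrier n) → dot h (-_ ∘ v) ≈ - dot h v
  dot-neg h v = trans (sum-cong-≋ λ c → sym (-‿distribʳ-* (h c) (v c))) (sym (sum-neg λ c → h c * v c))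

  semipositive-resp : {H R : SquareMatrix n} → (∀ l → H l ≡ R l) → Semipositive H → Semipositive R
  semipositive-resp H≡R (x , x≥0 , Hx>0) = x , x≥0 , λ l → ≡.subst (λ h → 0# < dot h x) (H≡R l) (Hx>0 l)

  -- The rows of `[Y|X]` and the exchange argument.

  module Joint {n} {b : Vector ℕ n} (M : BlockMatrix b) (X : SquareMatrix n) (Y : BlockMatrix b)
               (MX≈Y : ∀ p l → (M · X) p l ≈ Y p l) where

    M′ : BlockMatrix (b +𝟏)
    M′ = [ Y ∣ X ]

    M′-new : ∀ v j → (M′ ·ᵥ v) (new b j) ≈ (X ·ᵥ v) j
    M′-new v j = reflexive (≡.cong (λ h → dot h v) ([∣]-new Y X j))

    -- With `u = X v`, block `j` of `M′ v` consists of the entries of `M u` in that block followed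
    -- by `u j`. This juxtaposition makes the sign-reversal property of `M` applicable.
    M′-ι : ∀ v p → (M′ ·ᵥ v) (ι p) ≈ (M ·ᵥ (X ·ᵥ v)) p
    M′-ι v p = begin
      (M′ ·ᵥ v) (ι p) ≡⟨ ≡.cong (λ h → dot h v) ([∣]-ι Y X p) ⟩
      dot (Y p) v     ≈⟨ sum-cong-≋ (λ l → *-congʳ {v l} (MX≈Y p l)) ⟨
      sum (λ l → (sum λ k → M p k * X k l) * v l) ≈⟨ sum-assoc (M p) X v ⟨
      (M ·ᵥ (X ·ᵥ v)) p ∎

    module Walk (b≢0 : ∀ j → NonZero (b j)) (M-isP : IsBlockPMatrix M)
                (X-isZ : IsZMatrix X) (Y-isZ : IsBlockZMatrix Y) where

      M′-row-Z : ∀ p l → l ≢ proj₁ p → M′ p l ≤ 0#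
      M′-row-Z p l l≢ with view {b = b} p
      ... | old p′ = ≡.subst (λ h → h l ≤ 0#) (≡.sym ([∣]-ι Y X p′)) (block-Z-row {M = Y} b≢0 Y-isZ p′ l l≢)
      ... | last j = ≡.subst (λ h → h l ≤ 0#) (≡.sym ([∣]-new Y X j)) (X-isZ j l (l≢ ∘ ≡.sym))

      -- In each block some row of M reverses the sign of (X v)ⱼ, and M is a P-matrix.
      Xv≈0 : ∀ v → (∀ j → ∃ λ k → (M′ ·ᵥ v) (j , k) ≤ 0#) → (∀ j → ∃ λ k → 0# ≤ (M′ ·ᵥ v) (j , k)) →
             ∀ j → (X ·ᵥ v) j ≈ 0#
      Xv≈0 v low high = P-matrix-reverses-no-sign {A = λ j → M (j , σ j)} (M-isP (selects-complementary σ)) u (proj₂ ∘ reversal)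
        where
        u : Vector Carrier n
        u = X ·ᵥ v

        low-row : ∀ j → 0# < u j → ∀ k → (M′ ·ᵥ v) (j , k) ≤ 0# → ∃ λ i → u j * (M ·ᵥ u) (j , i) ≤ 0#
        low-row j u>0 k w≤0 = from (view {b = b} (j , k)) ≡.refl w≤0
          where
          from : ∀ {p} → View b p → proj₁ p ≡ j → (M′ ·ᵥ v) p ≤ 0# → ∃ λ i → u j * (M ·ᵥ u) (j , i) ≤ 0#
          from (old (j , i)) ≡.refl w≤0 = i , ≤0-resp-≈ (*-comm _ _)
            (0≤-x⇒x≤0 (x≤0∧0≤y⇒0≤-x*y (≤0-resp-≈ (M′-ι v (j , i)) w≤0) (inj₁ u>0)))
          -- The last entry of the block is `u j` itself, so the nonpositive entry must belong to a
          -- row of `M`.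
          from (last j)      ≡.refl w≤0 = contradiction u>0 (≤⇒≯ (≤0-resp-≈ (M′-new v j) w≤0))

        high-row : ∀ j → u j < 0# → ∀ k → 0# ≤ (M′ ·ᵥ v) (j , k) → ∃ λ i → u j * (M ·ᵥ u) (j , i) ≤ 0#
        high-row j u<0 k 0≤w = from (view {b = b} (j , k)) ≡.refl 0≤w
          where
          from : ∀ {p} → View b p → proj₁ p ≡ j → 0# ≤ (M′ ·ᵥ v) p → ∃ λ i → u j * (M ·ᵥ u) (j , i) ≤ 0#
          from (old (j , i)) ≡.refl 0≤w = i , 0≤-x⇒x≤0 (x≤0∧0≤y⇒0≤-x*y (inj₁ u<0) (0≤-resp-≈ (M′-ι v (j , i)) 0≤w))
          from (last j)      ≡.refl 0≤w = contradiction (0≤-resp-≈ (M′-new v j) 0≤w) (<⇒≱ u<0)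

        reversal : ∀ j → ∃ λ i → u j * (M ·ᵥ u) (j , i) ≤ 0#
        reversal j with <.compare (u j) 0#
        ... | tri< u<0 _ _ = high-row j u<0 _ (proj₂ (high j))
        ... | tri≈ _ u≈0 _ = inhabitant (b j) {{b≢0 j}} , inj₂ (trans (*-congʳ u≈0) (zeroˡ _))
        ... | tri> _ _ u>0 = low-row j u>0 _ (proj₂ (low j))

        σ : ∀ j → Fin (b j)
        σ j = proj₁ (reversal j)

      unsigned⇒null : ∀ v → (∀ j → ∃ λ k → (M′ ·ᵥ v) (j , k) ≤ 0#) → (∀ j → ∃ λ k → 0# ≤ (M′ ·ᵥ v) (j , k)) →
                      ∀ p → (M′ ·ᵥ v) p ≈ 0#
      unsigned⇒null v low high p with view {b = b} p
      ... | old p′ = trans (M′-ι v p′) (sum≈0 {t = λ k → M p′ k * (X ·ᵥ v) k} λ k → trans (*-congˡ (Xv≈0 v low high k)) (zeroʳ _))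
      ... | last j = trans (M′-new v j) (Xv≈0 v low high j)

      -- The rows that behave like a nonnegative combination of the rows of block j of M′.
      record Mixed (j : Fin n) (h : Vector Carrier n) : Set (c ⊔ ℓ₁ ⊔ ℓ₂) where
        field
          low    : ∀ v → dot h v ≤ 0# → ∃ λ k → (M′ ·ᵥ v) (j , k) ≤ 0#
          high   : ∀ v → 0# ≤ dot h v → ∃ λ k → 0# ≤ (M′ ·ᵥ v) (j , k)
          null   : ∀ v → (∀ k → (M′ ·ᵥ v) (j , k) ≈ 0#) → dot h v ≈ 0#
          isZRow : ∀ l → l ≢ j → h l ≤ 0#

      row-mixed : ∀ j k → Mixed j (M′ (j , k))
      row-mixed j k = record
        { low    = λ v h≤0 → k , h≤0
        ; high   = λ v 0≤h → k , 0≤h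
        ; null   = λ v w≈0 → w≈0 k
        ; isZRow = M′-row-Z (j , k)
        }

      -- If every entry of the block were positive, the combination would be positive too, thanks to
      -- the one positive weight; this gives `low`, and `high` is `low` for the negated vector.
      combination-mixed : ∀ j (y : Vector Carrier _) → (∀ k → 0# ≤ y k) → (∃ λ k → 0# < y k) →
                          Mixed j (λ l → sum λ k → y k * M′ (j , k) l)
      combination-mixed j y y≥0 (k₀ , y>0) = record { low = low ; high = high ; null = null ; isZRow = isZRow }
        where
        h : Vector Carrier n
        h l = sum λ k → y k * M′ (j , k) l

        hv : ∀ v → dot h v ≈ sum λ k → y k * (M′ ·ᵥ v) (j , k)
        hv v = sym (sum-assoc y (λ k → M′ (j , k)) v)

        low : ∀ v → dot h v ≤ 0# → ∃ λ k → (M′ ·ᵥ v) (j , k) ≤ 0#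
        low v h≤0 with Fin.any? (λ k → (M′ ·ᵥ v) (j , k) ≤?0)
        ... | yes found = found
        ... | no ¬found = contradiction (0<-resp-≈ (sym (hv v))
                (sum-pos {t = λ k → y k * (M′ ·ᵥ v) (j , k)} (λ k → 0≤x∧0≤y⇒0≤x*y (y≥0 k) (inj₁ (w>0 k))) k₀ (*-pos y>0 (w>0 k₀)))) (≤⇒≯ h≤0)
          where
          w>0 : ∀ k → 0# < (M′ ·ᵥ v) (j , k)
          w>0 k with <.compare 0# ((M′ ·ᵥ v) (j , k))
          ... | tri< p _ _ = p
          ... | tri≈ _ p _ = contradiction (k , inj₂ (sym p)) ¬found
          ... | tri> _ _ p = contradiction (k , inj₁ p) ¬found

        high : ∀ v → 0# ≤ dot h v → ∃ λ k → 0# ≤ (M′ ·ᵥ v) (j , k)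
        high v 0≤h with low (-_ ∘ v) (≤0-resp-≈ (sym (dot-neg h v)) (0≤x⇒-x≤0 0≤h))
        ... | k , w≤0 = k , 0≤-resp-≈ (-‿involutive _) (x≤0⇒0≤-x (≤0-resp-≈ (dot-neg (M′ (j , k)) v) w≤0))

        null : ∀ v → (∀ k → (M′ ·ᵥ v) (j , k) ≈ 0#) → dot h v ≈ 0#
        null v w≈0 = trans (hv v) (sum≈0 {t = λ k → y k * (M′ ·ᵥ v) (j , k)} λ k → trans (*-congˡ (w≈0 k)) (zeroʳ _))

        isZRow : ∀ l → l ≢ j → h l ≤ 0#
        isZRow l l≢j = 0≤-x⇒x≤0 (0≤-resp-≈ (sym (sum-neg λ k → y k * M′ (j , k) l))
          (sum-nonneg λ k → 0≤-resp-≈ (-‿cong (*-comm _ _)) (x≤0∧0≤y⇒0≤-x*y (M′-row-Z (j , k) l l≢j) (y≥0 k))))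

      rows-isZ : {H : SquareMatrix n} → (∀ j → Mixed j (H j)) → IsZMatrix H
      rows-isZ mixed i j i≢j = Mixed.isZRow (mixed i) j (i≢j ∘ ≡.sym)

      sufficient-multiple : ∀ x {y} → 0# < y → ∃ λ t → 0# ≤ t × 0# < x + t * y
      sufficient-multiple x {y} y>0 with <.compare 0# x | positive-inverse y>0
      ... | tri< 0<x _ _ | _ = 0# , inj₂ refl , 0<-resp-≈ (sym (trans (+-congˡ (zeroˡ y)) (+-identityʳ x))) 0<x
      ... | tri≈ _ 0≈x _ | _ = 1# , inj₁ 0<1 , 0≤x∧0<y⇒0<x+y (inj₂ 0≈x) (0<-resp-≈ (sym (*-identityˡ y)) y>0)
      -- The multiple `(1 - x) / y` is chosen to bring the sum to exactly one.
      ... | tri> _ _ x<0 | y⁻¹ , yy⁻¹≈1 , y⁻¹>0 = y⁻¹ * (1# - x) , inj₁ (*-pos y⁻¹>0 (0<x∧0≤y⇒0<x+y 0<1 (inj₁ (x<0⇒0<-x x<0)))) ,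
        0<-resp-≈ (sym (begin
          x + y⁻¹ * (1# - x) * y   ≈⟨ solve 4 (λ x y z o → x :+ z :* (o :- x) :* y := x :+ (y :* z) :* (o :- x)) refl x y y⁻¹ 1# ⟩
          x + (y * y⁻¹) * (1# - x) ≈⟨ +-congˡ (trans (*-congʳ yy⁻¹≈1) (*-identityˡ _)) ⟩
          x + (1# - x)             ≈⟨ solve 2 (λ x o → x :+ (o :- x) := o) refl x 1# ⟩
          1#                       ∎)) 0<1

      dot-combination : ∀ (h x v : Vector Carrier n) t → dot h (λ k → x k + t * v k) ≈ dot h x + t * dot h v
      dot-combination h x v t = trans
        (sum-cong-≋ λ k → solve 4 (λ h x t v → h :* (x :+ t :* v) := h :* x :+ t :* (h :* v)) refl (h k) (x k) t (v k))
        (sum-linear (λ k → h k * x k) (λ k → h k * v k) t)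

      replace : SquareMatrix n → Fin n → Vector Carrier n → SquareMatrix n
      replace H j h = updateAt H j λ _ → h

      -- The nonnegative solution v of H v = eⱼ is mapped to positive by any mixed row h of
      -- block j, so adding a multiple of v repairs the row that is replaced.
      replace-semipositive : ∀ {H : SquareMatrix n} → (∀ l → Mixed l (H l)) → Semipositive H →
                             ∀ j {h} → Mixed j h → Semipositive (replace H j h)
      replace-semipositive {H} mixed S@(x , x≥0 , Hx>0) j {h} h-mixed = x′ , x′≥0 , Hx′>0
        where
        open NonnegativeInverse (nonnegativeInverse H (rows-isZ mixed) S)
        v : Vector Carrier n
        v k = A⁻¹ k j

        null⇒⊥ : ¬ (∀ p → (M′ ·ᵥ v) p ≈ 0#)
        null⇒⊥ w≈0 = 0≉1 (trans (sym (Mixed.null (mixed j) v λ k → w≈0 (j , k))) (trans (inverseʳ j j) (𝟙-diagonal j)))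

        low : dot h v ≤ 0# → ∀ l → ∃ λ k → (M′ ·ᵥ v) (l , k) ≤ 0#
        low hv≤0 l with l Fin.≟ j
        ... | yes ≡.refl = Mixed.low h-mixed v hv≤0
        ... | no l≢j     = Mixed.low (mixed l) v (inj₂ (trans (inverseʳ l j) (𝟙-off-diagonal l≢j)))

        high : ∀ l → ∃ λ k → 0# ≤ (M′ ·ᵥ v) (l , k)
        -- In block `j` the two signs come from different rows: the entry that is at least zero from
        -- the old row `H j`, where `v` has value one, and the entry that is at most zero from its
        -- replacement `h`.
        high l = Mixed.high (mixed l) v (0≤-resp-≈ (sym (inverseʳ l j)) (0≤𝟙 l j))

        hv>0 : 0# < dot h v
        hv>0 with dot h v ≤?0
        ... | yes hv≤0 = contradiction (unsigned⇒null v (low hv≤0) high) null⇒⊥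
        ... | no hv≰0  = ≰⇒> hv≰0

        t : Carrier
        t = proj₁ (sufficient-multiple (dot h x) hv>0)

        0≤t : 0# ≤ t
        0≤t = proj₁ (proj₂ (sufficient-multiple (dot h x) hv>0))

        x′ : Vector Carrier n
        x′ k = x k + t * v k

        x′≥0 : ∀ k → 0# ≤ x′ k
        x′≥0 k = 0≤x∧0≤y⇒0≤x+y (x≥0 k) (0≤x∧0≤y⇒0≤x*y 0≤t (A⁻¹≥0 k j))

        Hx′>0 : ∀ l → 0# < (replace H j h ·ᵥ x′) l
        Hx′>0 l with l Fin.≟ j
        ... | yes ≡.refl = ≡.subst (λ r → 0# < dot r x′) (≡.sym (updateAt-updates j H))
                (0<-resp-≈ (sym (dot-combination h x v t)) (proj₂ (proj₂ (sufficient-multiple (dot h x) hv>0))))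
        ... | no l≢j     = ≡.subst (λ r → 0# < dot r x′) (≡.sym (updateAt-minimal l j H l≢j))
                (0<-resp-≈ (sym (dot-combination (H l) x v t))
                  (0<x∧0≤y⇒0<x+y (Hx>0 l) (0≤x∧0≤y⇒0≤x*y 0≤t (0≤-resp-≈ (sym (inverseʳ l j)) (0≤𝟙 l j)))))

      mixed-semipositive : ∀ {H R : SquareMatrix n} → (∀ l → Mixed l (H l)) → Semipositive H →
                           (∀ l → Mixed l (R l)) → Semipositive R
      mixed-semipositive {H} {R} H-mixed H-semipositive R-mixed = agreeing (replaced n ℕ.≤-refl)
        where
        AgreeingUpTo : ℕ → Set _
        AgreeingUpTo k = ∃ λ H → (∀ l → toℕ l ℕ.< k → H l ≡ R l) × (∀ l → Mixed l (H l)) × Semipositive H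

        replaced : ∀ k → k ℕ.≤ n → AgreeingUpTo k
        replaced zero    _   = H , (λ _ ()) , H-mixed , H-semipositive
        replaced (suc k) k<n with replaced k (ℕ.<⇒≤ k<n)
        ... | H , H≡R , mixed , S = replace H j (R j) , agrees , mixed′ , replace-semipositive mixed S j (R-mixed j)
          where
          j = Fin.fromℕ< k<n

          agrees : ∀ l → toℕ l ℕ.< suc k → replace H j (R j) l ≡ R l
          agrees l l<1+k with l Fin.≟ j
          ... | yes ≡.refl = updateAt-updates j H
          ... | no l≢j     = ≡.trans (updateAt-minimal l j H l≢j) (H≡R l (ℕ.≤∧≢⇒< (ℕ.s≤s⁻¹ l<1+k) λ e →
                l≢j (Fin.toℕ-injective (≡.trans e (≡.sym (Fin.toℕ-fromℕ< k<n))))))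

          mixed′ : ∀ l → Mixed l (replace H j (R j) l)
          mixed′ l with l Fin.≟ j
          ... | yes ≡.refl = ≡.subst (Mixed l) (≡.sym (updateAt-updates j H)) (R-mixed j)
          ... | no l≢j     = ≡.subst (Mixed l) (≡.sym (updateAt-minimal l j H l≢j)) (mixed l)

        agreeing : AgreeingUpTo n → Semipositive R
        agreeing (_ , H≡R , _ , S) = semipositive-resp (λ l → H≡R l (Fin.toℕ<n l)) S

      module _ (r : Vector Carrier n) (s : BlockVector b) (r≥0 : ∀ j → 0# ≤ r j) (s≥0 : ∀ p → 0# ≤ s p)
               (Xᵀr+Yᵀs>0 : ∀ l → 0# < (sum λ j → X j l * r j) + (sumᵇ λ p → Y p l * s p)) where

        weight : BlockVector (b +𝟏)
        weight = [ s ∣ r ]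

        weight≥0 : ∀ p → 0# ≤ weight p
        weight≥0 p with view {b = b} p
        ... | old p′ = ≡.subst (0# ≤_) (≡.sym ([∣]-ι s r p′)) (s≥0 p′)
        ... | last j = ≡.subst (0# ≤_) (≡.sym ([∣]-new s r j)) (r≥0 j)

        aggregate : SquareMatrix n
        aggregate j l = sum λ k → weight (j , k) * M′ (j , k) l

        aggregate-isZ : IsZMatrix aggregate
        aggregate-isZ j l j≢l = 0≤-x⇒x≤0 (0≤-resp-≈ (sym (sum-neg λ k → weight (j , k) * M′ (j , k) l))
          (sum-nonneg λ k → 0≤-resp-≈ (-‿cong (*-comm _ _)) (x≤0∧0≤y⇒0≤-x*y (M′-row-Z (j , k) l (j≢l ∘ ≡.sym)) (weight≥0 (j , k)))))

        aggregate-entry : ∀ j l → aggregate j l ≈ X j l * r j + sum λ i → Y (j , i) l * s (j , i)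
        aggregate-entry j l = begin
          aggregate j l ≈⟨ sum-last (λ k → weight (j , k) * M′ (j , k) l) ⟩
          sum (λ i → weight (ι (j , i)) * M′ (ι (j , i)) l) + weight (new b j) * M′ (new b j) l
            ≈⟨ +-cong (sum-cong-≋ λ i → reflexive (≡.cong₂ (λ w h → w * h l) ([∣]-ι s r (j , i)) ([∣]-ι Y X (j , i))))
                      (reflexive (≡.cong₂ (λ w h → w * h l) ([∣]-new s r j) ([∣]-new Y X j))) ⟩
          sum (λ i → s (j , i) * Y (j , i) l) + r j * X j l
            ≈⟨ trans (+-cong (sum-cong-≋ λ i → *-comm (s (j , i)) (Y (j , i) l)) (*-comm _ _)) (+-comm _ _) ⟩
          X j l * r j + sum (λ i → Y (j , i) l * s (j , i)) ∎

        aggregate-semipositive : Semipositive aggregate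
        aggregate-semipositive = semipositive-transpose aggregate aggregate-isZ
          ((λ _ → 1#) , (λ _ → inj₁ 0<1) , λ l → 0<-resp-≈ (sym (begin
            sum (λ j → aggregate j l * 1#) ≈⟨ sum-cong-≋ (λ j → trans (*-identityʳ _) (aggregate-entry j l)) ⟩
            sum (λ j → X j l * r j + sum λ i → Y (j , i) l * s (j , i))
              ≈⟨ ∑-distrib-+ (λ j → X j l * r j) (λ j → sum λ i → Y (j , i) l * s (j , i)) ⟩
            sum (λ j → X j l * r j) + (sumᵇ λ p → Y p l * s p) ∎)) (Xᵀr+Yᵀs>0 l))

        -- Passing to the one-by-one principal submatrix moves index `j` into the corner, where
        -- `semipositive-corner` applies.
        aggregate-diagonal : ∀ j → 0# < aggregate j j
        aggregate-diagonal j = semipositive-corner (λ (_ _ : Fin 1) → aggregate j j) (λ { zero zero e → contradiction ≡.refl e })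
          (semipositive-principal aggregate (λ (_ : Fin 1) → j) (λ { {zero} {zero} _ → ≡.refl }) aggregate-isZ aggregate-semipositive)

        -- If all weights of a block vanished, so would the diagonal entry of `aggregate` in that
        -- block. This supplies the positive weight that `combination-mixed` asks for.
        positive-weight : ∀ j → ∃ λ k → 0# < weight (j , k)
        positive-weight j with Fin.any? (λ k → 0# <.<? weight (j , k))
        ... | yes found = found
        ... | no ¬found = contradiction (aggregate-diagonal j) (≤⇒≯ (inj₂ (sum≈0 {t = λ k → weight (j , k) * M′ (j , k) j} λ k →
                trans (*-congʳ (weight≈0 k (weight≥0 (j , k)))) (zeroˡ _))))
          where
          weight≈0 : ∀ k → 0# ≤ weight (j , k) → weight (j , k) ≈ 0#
          weight≈0 k (inj₁ p) = contradiction (k , p) ¬found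
          weight≈0 k (inj₂ p) = sym p

        mixed⇒semipositive : ∀ {R : SquareMatrix n} → (∀ l → Mixed l (R l)) → Semipositive R
        mixed⇒semipositive = mixed-semipositive
          (λ j → combination-mixed j (λ k → weight (j , k)) (λ k → weight≥0 (j , k)) (positive-weight j)) aggregate-semipositive

        M′-isK : IsBlockKMatrix M′
        M′-isK = (λ mc → semipositive⇒P (representative M′ mc) (isZ mc) (mixed⇒semipositive λ l → row-mixed l _)) , isZ
          where
          isZ : IsBlockZMatrix M′
          isZ mc i j i≢j = M′-row-Z (i , proj₁ (mc i)) j (i≢j ∘ ≡.sym)

        -- `X` is itself a representative of `M′`, the one selecting the last row of every block.
        X-inverse : NonnegativeInverse X
        X-inverse = nonnegativeInverse X X-isZ (mixed⇒semipositive λ l → ≡.subst (Mixed l) ([∣]-new Y X l) (row-mixed l (b l ↑ʳ zero)))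

  -- Finite sums over blocks

  sumᵇ-cong : {b : Vector ℕ n} {s t : BlockVector b} → (∀ p → s p ≈ t p) → sumᵇ s ≈ sumᵇ t
  sumᵇ-cong s≈t = sum-cong-≋ λ j → sum-cong-≋ λ i → s≈t (j , i)

  sumᵇ≈0 : {b : Vector ℕ n} {t : BlockVector b} → (∀ p → t p ≈ 0#) → sumᵇ t ≈ 0#
  sumᵇ≈0 {t = t} t≈0 = sum≈0 {t = λ j → sum λ i → t (j , i)} λ j → sum≈0 {t = λ i → t (j , i)} λ i → t≈0 (j , i)

  sumᵇ-distrib-+ : {b : Vector ℕ n} (s t : BlockVector b) → sumᵇ (λ p → s p + t p) ≈ sumᵇ s + sumᵇ t
  sumᵇ-distrib-+ s t = trans (sum-cong-≋ λ j → ∑-distrib-+ (λ i → s (j , i)) (λ i → t (j , i)))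
    (∑-distrib-+ (λ j → sum λ i → s (j , i)) (λ j → sum λ i → t (j , i)))

  *-distribˡ-sumᵇ : {b : Vector ℕ n} → ∀ x (t : BlockVector b) → x * sumᵇ t ≈ sumᵇ λ p → x * t p
  *-distribˡ-sumᵇ x t = trans (*-distribˡ-sum x λ j → sum λ i → t (j , i)) (sum-cong-≋ λ j → *-distribˡ-sum x λ i → t (j , i))

  *-distribʳ-sumᵇ : {b : Vector ℕ n} → ∀ x (t : BlockVector b) → sumᵇ t * x ≈ sumᵇ λ p → t p * x
  *-distribʳ-sumᵇ x t = trans (*-comm _ x) (trans (*-distribˡ-sumᵇ x t) (sumᵇ-cong λ p → *-comm x (t p)))

  sumᵇ-neg : {b : Vector ℕ n} (t : BlockVector b) → - sumᵇ t ≈ sumᵇ λ p → - t p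
  sumᵇ-neg t = trans (sum-neg λ j → sum λ i → t (j , i)) (sum-cong-≋ λ j → sum-neg λ i → t (j , i))

  sumᵇ-sum-comm : {b : Vector ℕ n} (t : Idx b → Vector Carrier m) → sumᵇ (λ p → sum (t p)) ≈ sum λ l → sumᵇ λ p → t p l
  sumᵇ-sum-comm t = trans (sum-cong-≋ λ j → ∑-comm λ i l → t (j , i) l) (∑-comm λ j l → sum λ i → t (j , i) l)

  sumᵇ-comm : {b : Vector ℕ n} {b′ : Vector ℕ m} (t : Idx b → BlockVector b′) →
              sumᵇ (λ p → sumᵇ (t p)) ≈ sumᵇ λ p′ → sumᵇ λ p → t p p′
  sumᵇ-comm t = trans (sumᵇ-sum-comm λ p j → sum λ i → t p (j , i)) (sum-cong-≋ λ j → sumᵇ-sum-comm λ p i → t p (j , i))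

  sumᵇ-single : {b : Vector ℕ n} {t : BlockVector b} → ∀ p → (∀ p′ → p′ ≢ p → t p′ ≈ 0#) → sumᵇ t ≈ t p
  sumᵇ-single {t = t} (j , i) t≈0 = trans
    (sum-single {t = λ j → sum λ i → t (j , i)} j λ j′ j′≢j → sum≈0 {t = λ i → t (j′ , i)} λ i′ → t≈0 (j′ , i′) (j′≢j ∘ ≡.cong proj₁))
    (sum-single {t = λ i → t (j , i)} i λ i′ i′≢i → t≈0 (j , i′) (i′≢i ∘ Product.,-injectiveʳ))

  sumᵇ-last : {b : Vector ℕ n} (t : BlockVector (b +𝟏)) → sumᵇ t ≈ sumᵇ (λ p → t (ι {b = b} p)) + sum λ j → t (new b j)
  sumᵇ-last {b = b} t = trans (sum-cong-≋ λ j → sum-last λ i → t (j , i))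
    (∑-distrib-+ (λ j → sum λ i → t (ι {b = b} (j , i))) (λ j → t (new b j)))

  sumᵇ-sumᵇ-assoc : {b : Vector ℕ n} {b′ : Vector ℕ m} (s : BlockVector b) (B : Idx b → BlockVector b′) (t : BlockVector b′) →
                    sumᵇ (λ k → s k * sumᵇ λ p → B k p * t p) ≈ sumᵇ λ p → (sumᵇ λ k → s k * B k p) * t p
  sumᵇ-sumᵇ-assoc s B t = begin
    sumᵇ (λ k → s k * sumᵇ λ p → B k p * t p)
      ≈⟨ sumᵇ-cong (λ k → trans (*-distribˡ-sumᵇ (s k) λ p → B k p * t p) (sumᵇ-cong λ p → sym (*-assoc (s k) (B k p) (t p)))) ⟩
    sumᵇ (λ k → sumᵇ λ p → s k * B k p * t p) ≈⟨ sumᵇ-comm (λ k p → s k * B k p * t p) ⟩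
    sumᵇ (λ p → sumᵇ λ k → s k * B k p * t p) ≈⟨ sumᵇ-cong (λ p → *-distribʳ-sumᵇ (t p) λ k → s k * B k p) ⟨
    sumᵇ (λ p → (sumᵇ λ k → s k * B k p) * t p) ∎

  sumᵇ-sum-assoc : {b : Vector ℕ n} (s : BlockVector b) (B : Idx b → Vector Carrier m) (t : Vector Carrier m) →
                   sumᵇ (λ k → s k * sum λ l → B k l * t l) ≈ sum λ l → (sumᵇ λ k → s k * B k l) * t l
  sumᵇ-sum-assoc s B t = begin
    sumᵇ (λ k → s k * sum λ l → B k l * t l)
      ≈⟨ sumᵇ-cong (λ k → trans (*-distribˡ-sum (s k) λ l → B k l * t l) (sum-cong-≋ λ l → sym (*-assoc (s k) (B k l) (t l)))) ⟩
    sumᵇ (λ k → sum λ l → s k * B k l * t l) ≈⟨ sumᵇ-sum-comm (λ k l → s k * B k l * t l) ⟩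
    sum (λ l → sumᵇ λ k → s k * B k l * t l) ≈⟨ sum-cong-≋ (λ l → *-distribʳ-sumᵇ (t l) λ k → s k * B k l) ⟨
    sum (λ l → (sumᵇ λ k → s k * B k l) * t l) ∎

  sum-sumᵇ-assoc : {b : Vector ℕ n} (s : Vector Carrier m) (B : Fin m → BlockVector b) (t : BlockVector b) →
                   sum (λ l → s l * sumᵇ λ p → B l p * t p) ≈ sumᵇ λ p → (sum λ l → s l * B l p) * t p
  sum-sumᵇ-assoc s B t = begin
    sum (λ l → s l * sumᵇ λ p → B l p * t p)
      ≈⟨ sum-cong-≋ (λ l → trans (*-distribˡ-sumᵇ (s l) λ p → B l p * t p) (sumᵇ-cong λ p → sym (*-assoc (s l) (B l p) (t p)))) ⟩
    sum (λ l → sumᵇ λ p → s l * B l p * t p) ≈⟨ sumᵇ-sum-comm (λ p l → s l * B l p * t p) ⟨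
    sumᵇ (λ p → sum λ l → s l * B l p * t p) ≈⟨ sumᵇ-cong (λ p → *-distribʳ-sum (t p) λ l → s l * B l p) ⟨
    sumᵇ (λ p → (sum λ l → s l * B l p) * t p) ∎

  δ-refl : {b : Vector ℕ n} (p : Idx b) → δ p p ≈ 1#
  δ-refl p with p ≟ p
  ... | yes _  = refl
  ... | no p≢p = contradiction ≡.refl p≢p

  δ-≢ : {b : Vector ℕ n} {p p′ : Idx b} → p ≢ p′ → δ p p′ ≈ 0#
  δ-≢ {p = p} {p′} p≢p′ with p ≟ p′
  ... | yes p≡p′ = contradiction p≡p′ p≢p′
  ... | no _     = refl

  δ-ι : {b : Vector ℕ n} (p p′ : Idx b) → δ (ι p) (ι p′) ≈ δ p p′
  δ-ι p p′ with p ≟ p′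
  ... | yes ≡.refl = δ-refl (ι p)
  ... | no p≢p′    = δ-≢ (p≢p′ ∘ ι-injective)

  δ-ι-new : {b : Vector ℕ n} (p : Idx b) (j : Fin n) → δ (ι p) (new b j) ≈ 0#
  δ-ι-new p j = δ-≢ (ι≢new p {j})

  δ-new-ι : {b : Vector ℕ n} (j : Fin n) (p : Idx b) → δ (new b j) (ι p) ≈ 0#
  δ-new-ι j p = δ-≢ (ι≢new p {j} ∘ ≡.sym)

  δ-new : (b : Vector ℕ n) (i j : Fin n) → δ (new b i) (new b j) ≈ 𝟙 i j
  δ-new b i j = by-cases (i Fin.≟ j)
    where
    by-cases : Dec (i ≡ j) → δ (new b i) (new b j) ≈ 𝟙 i j
    by-cases (yes ≡.refl) = trans (δ-refl (new b i)) (sym (𝟙-diagonal i))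
    by-cases (no i≢j)     = trans (δ-≢ (i≢j ∘ ≡.cong proj₁)) (sym (𝟙-off-diagonal i≢j))

  sumᵇ-δˡ : {b : Vector ℕ n} (p : Idx b) (t : BlockVector b) → sumᵇ (λ k → δ p k * t k) ≈ t p
  sumᵇ-δˡ p t = trans (sumᵇ-single {t = λ k → δ p k * t k} p λ k k≢p → trans (*-congʳ (δ-≢ (k≢p ∘ ≡.sym))) (zeroˡ _))
                      (trans (*-congʳ (δ-refl p)) (*-identityˡ _))

  sumᵇ-δʳ : {b : Vector ℕ n} (p : Idx b) (t : BlockVector b) → sumᵇ (λ k → t k * δ k p) ≈ t p
  sumᵇ-δʳ p t = trans (sumᵇ-single {t = λ k → t k * δ k p} p λ k k≢p → trans (*-congˡ (δ-≢ k≢p)) (zeroʳ _))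
                      (trans (*-congˡ (δ-refl p)) (*-identityʳ _))

  -- Products with `[I|-M]` from the right and from the left.

  infixl 7 _·ᴵ_ _ᵀ·_

  _·ᴵ_ : {b : Vector ℕ n} (M : BlockMatrix b) → BlockVector (b +𝟏) → BlockVector b
  (M ·ᴵ x) p = sumᵇ λ k → [I∣- M ] p k * x k

  _ᵀ·_ : {b : Vector ℕ n} → BlockVector b → BlockMatrix b → Vector Carrier n
  (g ᵀ· M) l = sumᵇ λ p → g p * M p l

  [I∣-]-ι : {b : Vector ℕ n} (M : BlockMatrix b) → ∀ p p′ → [I∣- M ] p (ι p′) ≡ δ p p′
  [I∣-]-ι M p = [∣]-ι (δ p) (λ j → - M p j)

  [I∣-]-new : {b : Vector ℕ n} (M : BlockMatrix b) → ∀ p j → [I∣- M ] p (new b j) ≡ - M p j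
  [I∣-]-new M p = [∣]-new (δ p) (λ j → - M p j)

  ·ᴵ-expand : {b : Vector ℕ n} (M : BlockMatrix b) (x : BlockVector (b +𝟏)) → ∀ p →
              (M ·ᴵ x) p ≈ x (ι p) - (M ·ᵥ (λ j → x (new b j))) p
  ·ᴵ-expand {b = b} M x p = begin
    (M ·ᴵ x) p ≈⟨ sumᵇ-last (λ k → [I∣- M ] p k * x k) ⟩
    sumᵇ (λ p′ → [I∣- M ] p (ι p′) * x (ι p′)) + sum (λ j → [I∣- M ] p (new b j) * x (new b j))
      ≈⟨ +-cong (sumᵇ-cong λ p′ → *-congʳ {x (ι p′)} (reflexive ([I∣-]-ι M p p′)))
                (sum-cong-≋ λ j → trans (*-congʳ {x (new b j)} (reflexive ([I∣-]-new M p j))) (sym (-‿distribˡ-* (M p j) (x (new b j))))) ⟩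
    sumᵇ (λ p′ → δ p p′ * x (ι p′)) + sum (λ j → - (M p j * x (new b j)))
      ≈⟨ +-cong (sumᵇ-δˡ p λ p′ → x (ι p′)) (sym (sum-neg λ j → M p j * x (new b j))) ⟩
    x (ι p) - (M ·ᵥ (λ j → x (new b j))) p ∎

  -- This is the row vector `g [I|-M]`. The columns of `[I|-M]` and the rows of `[Y|X]` share the
  -- index set `N(b + 𝟏)`, so the same vector can also multiply `[Y|X]` from the left.
  extend : {b : Vector ℕ n} → BlockMatrix b → BlockVector b → BlockVector (b +𝟏)
  extend M g = [ g ∣ (λ l → - (g ᵀ· M) l) ]

  extend-correct : {b : Vector ℕ n} (M : BlockMatrix b) (g : BlockVector b) → ∀ k → (sumᵇ λ p → g p * [I∣- M ] p k) ≈ extend M g k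
  extend-correct {b = b} M g k with view {b = b} k
  ... | old p′ = begin
    sumᵇ (λ p → g p * [I∣- M ] p (ι p′)) ≈⟨ sumᵇ-cong (λ p → *-congˡ {g p} (reflexive ([I∣-]-ι M p p′))) ⟩
    sumᵇ (λ p → g p * δ p p′)            ≈⟨ sumᵇ-δʳ p′ g ⟩
    g p′                                 ≡⟨ [∣]-ι g (λ l → - (g ᵀ· M) l) p′ ⟨
    extend M g (ι p′)                    ∎
  ... | last j = begin
    sumᵇ (λ p → g p * [I∣- M ] p (new b j)) ≈⟨ sumᵇ-cong (λ p → trans (*-congˡ {g p} (reflexive ([I∣-]-new M p j))) (sym (-‿distribʳ-* (g p) (M p j)))) ⟩
    sumᵇ (λ p → - (g p * M p j))            ≈⟨ sumᵇ-neg (λ p → g p * M p j) ⟨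
    - (g ᵀ· M) j                            ≡⟨ [∣]-new g (λ l → - (g ᵀ· M) l) j ⟨
    extend M g (new b j)                    ∎

  -- Solution bases and arcs

  ι∈↑⁻ : {B : Pred (Idx b) 0ℓ} {p : Idx b} → ι p ∈ ↑ B → p ∈ B
  ι∈↑⁻ {B = B} (p′ , p′∈B , e) = ≡.subst (_∈ B) (≡.sym (ι-injective e)) p′∈B

  new∉↑ : {B : Pred (Idx b) 0ℓ} {j : Fin n} → new b j ∉ ↑ B
  new∉↑ {j = j} (p′ , _ , e) = ι≢new p′ {j} (≡.sym e)

  ↑-complementary : {B : Pred (Idx b) 0ℓ} → MaximalComplementary B → MaximalComplementary (↑ B)
  ↑-complementary {B = B} mc j = i ↑ˡ 1 , ((j , i) , i∈B , ≡.refl) , unique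
    where
    i = proj₁ (mc j)
    i∈B = proj₁ (proj₂ (mc j))
    unique : ∀ {k} → (j , k) ∈ ↑ B → i ↑ˡ 1 ≡ k
    unique (_ , i′∈B , ≡.refl) = ≡.cong (_↑ˡ 1) (proj₂ (proj₂ (mc j)) i′∈B)

  ∁-↑ : {B N : Pred (Idx b) 0ℓ} → N ≐ ∁ B → (↑ N ∪ New b) ≐ ∁ (↑ B)
  ∁-↑ {b = b} {B} {N} (N⊆∁B , ∁B⊆N) = to , from
    where
    to : ∀ {p} → p ∈ ↑ N ∪ New b → p ∉ ↑ B
    to (inj₁ (p′ , p′∈N , ≡.refl)) ιp′∈↑B = N⊆∁B p′∈N (ι∈↑⁻ ιp′∈↑B)
    to (inj₂ (j , ≡.refl)) new∈↑B = new∉↑ {B = B} new∈↑B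
    from : ∀ {p} → p ∉ ↑ B → p ∈ ↑ N ∪ New b
    from {p} p∉↑B with view {b = b} p
    ... | old p′ = inj₁ (p′ , ∁B⊆N (λ p′∈B → p∉↑B (p′ , p′∈B , ≡.refl)) , ≡.refl)
    ... | last j = inj₂ (j , ≡.refl)

  module _ {N : Pred (Idx b) 0ℓ} {B′ : Pred (Idx (b +𝟏)) 0ℓ} (mc : MaximalComplementary B′)
           (N′≐∁B′ : (↑ N ∪ New b) ≐ ∁ B′) where

    -- All of `New b` lies in the complement of `B′`, so the element that `B′` selects in each block
    -- is an old one.
    ι⁻¹-complementary : MaximalComplementary {b = b} (λ p → ι p ∈ B′)
    ι⁻¹-complementary j with mc j
    ... | k , k∈B′ , k-unique = from (view {b = b} (j , k)) ≡.refl k∈B′ k-unique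
      where
      from : ∀ {p} → View b p → (e : proj₁ p ≡ j) → p ∈ B′ → (∀ {k} → (proj₁ p , k) ∈ B′ → proj₂ p ≡ k) →
             ∃ λ i → ι {b = b} (j , i) ∈ B′ × (∀ {i′} → ι {b = b} (j , i′) ∈ B′ → i ≡ i′)
      from (old (j , i)) ≡.refl p∈B′ unique = i , p∈B′ , λ i′∈B′ → Fin.↑ˡ-injective 1 i _ (unique i′∈B′)
      from (last j) ≡.refl p∈B′ unique = contradiction p∈B′ (proj₁ N′≐∁B′ (inj₂ (j , ≡.refl)))

    ι⁻¹-∁ : N ≐ ∁ (λ p → ι p ∈ B′)
    ι⁻¹-∁ = (λ {p} p∈N → proj₁ N′≐∁B′ (inj₁ (p , p∈N , ≡.refl))) , from
      where
      from : ∀ {p} → ι p ∉ B′ → p ∈ N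
      from {p} p∉B′ with proj₂ N′≐∁B′ p∉B′
      ... | inj₁ ιp∈↑N     = ι∈↑⁻ ιp∈↑N
      ... | inj₂ (j , e)   = contradiction e (ι≢new p {j})

  module _ {B C : Pred (Idx b) 0ℓ} {p k : Idx b} where

    exchange-↑ : C ≐ ((B ∖ ｛ p ｝) ∪ ｛ k ｝) → ↑ C ≐ ((↑ B ∖ ｛ ι p ｝) ∪ ｛ ι k ｝)
    exchange-↑ (C⊆ , ⊆C) = to , from
      where
      to : ∀ {r} → r ∈ ↑ C → r ∈ (↑ B ∖ ｛ ι p ｝) ∪ ｛ ι k ｝
      to (r′ , r′∈C , ≡.refl) with C⊆ r′∈C
      ... | inj₁ (r′∈B , r′≢p) = inj₁ ((r′ , r′∈B , ≡.refl) , r′≢p ∘ ι-injective)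
      ... | inj₂ ≡.refl        = inj₂ ≡.refl
      from : ∀ {r} → r ∈ (↑ B ∖ ｛ ι p ｝) ∪ ｛ ι k ｝ → r ∈ ↑ C
      from (inj₁ ((r′ , r′∈B , ≡.refl) , ιr′≢ιp)) = r′ , ⊆C (inj₁ (r′∈B , λ p≡r′ → ιr′≢ιp (≡.cong ι p≡r′))) , ≡.refl
      from (inj₂ ≡.refl) = k , ⊆C (inj₂ ≡.refl) , ≡.refl

    exchange-↑⁻ : ↑ C ≐ ((↑ B ∖ ｛ ι p ｝) ∪ ｛ ι k ｝) → C ≐ ((B ∖ ｛ p ｝) ∪ ｛ k ｝)
    exchange-↑⁻ (↑C⊆ , ⊆↑C) = to , from
      where
      to : ∀ {r} → r ∈ C → r ∈ (B ∖ ｛ p ｝) ∪ ｛ k ｝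
      to {r} r∈C with ↑C⊆ (r , r∈C , ≡.refl)
      ... | inj₁ (ιr∈↑B , ιr≢ιp) = inj₁ (ι∈↑⁻ ιr∈↑B , λ p≡r → ιr≢ιp (≡.cong ι p≡r))
      ... | inj₂ ιk≡ιr           = inj₂ (ι-injective ιk≡ιr)
      from : ∀ {r} → r ∈ (B ∖ ｛ p ｝) ∪ ｛ k ｝ → r ∈ C
      from {r} (inj₁ (r∈B , r≢p)) = ι∈↑⁻ (⊆↑C (inj₁ ((r , r∈B , ≡.refl) , λ ιp≡ιr → r≢p (ι-injective ιp≡ιr))))
      from {r} (inj₂ ≡.refl)      = ι∈↑⁻ (⊆↑C (inj₂ ≡.refl))

  -- An arbitrary predicate is not decidable, but here membership amounts to equality with the
  -- selected index of the block.
  decide-∈ : {B : Pred (Idx b) 0ℓ} → MaximalComplementary B → ∀ p → Dec (p ∈ B)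
  decide-∈ {B = B} mc (j , i) with proj₁ (mc j) Fin.≟ i
  ... | yes e = yes (≡.subst (λ i → (j , i) ∈ B) e (proj₁ (proj₂ (mc j))))
  ... | no ≢i = no λ i∈B → ≢i (proj₂ (proj₂ (mc j)) i∈B)

  ·ᵥ-add : {R : Set} (A : R → Vector Carrier n) (x y : Vector Carrier n) → ∀ p → (A ·ᵥ (λ k → x k + y k)) p ≈ (A ·ᵥ x) p + (A ·ᵥ y) p
  ·ᵥ-add A x y p = trans (sum-cong-≋ λ k → distribˡ (A p k) (x k) (y k)) (∑-distrib-+ (λ k → A p k * x k) (λ k → A p k * y k))

  -- Transfer of solutions between the two systems.

  module Correspondence {n} {b : Vector ℕ n} (M : BlockMatrix b) (q : BlockVector b)
                        (X : SquareMatrix n) (Y : BlockMatrix b) (MX≈Y : ∀ p l → (M · X) p l ≈ Y p l)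
                        (X-inverse : NonnegativeInverse X) (f : Vector Carrier n) (f>0 : ∀ j → 0# < f j) where

    open Joint M X Y MX≈Y
    open NonnegativeInverse X-inverse renaming (A⁻¹ to X⁻¹; A⁻¹≥0 to X⁻¹≥0)

    q′ : BlockVector (b +𝟏)
    q′ = [ (λ p → q p - (M ·ᵥ f) p) ∣ (λ j → - f j) ]

    solve-X : ∀ (y : Vector Carrier n) j → (X ·ᵥ (X⁻¹ ·ᵥ y)) j ≈ y j
    solve-X y j = begin
      (X ·ᵥ (X⁻¹ ·ᵥ y)) j ≈⟨ sum-assoc (X j) X⁻¹ y ⟩
      sum (λ l → (sum λ k → X j k * X⁻¹ k l) * y l) ≈⟨ sum-cong-≋ (λ l → *-congʳ {y l} (inverseʳ j l)) ⟩
      sum (λ l → 𝟙 j l * y l) ≈⟨ sum-𝟙ˡ j y ⟩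
      y j ∎

    -- If X z′ = z + y, where z is the new part of the slack vector of a solution of the
    -- larger system, then M′ z′ = Y z′ = M (z + y) in the old rows.
    ·ᴵ-ι : ∀ (x′ : BlockVector ((b +𝟏) +𝟏)) y →
           (∀ j → (X ·ᵥ (λ l → x′ (new (b +𝟏) l))) j ≈ x′ (ι {b = b +𝟏} (new b j)) + y j) →
           ∀ p → (M′ ·ᴵ x′) (ι p) ≈ (M ·ᴵ (λ k → x′ (ι {b = b +𝟏} k))) p - (M ·ᵥ y) p
    ·ᴵ-ι x′ y Xz′ p = begin
      (M′ ·ᴵ x′) (ι p) ≈⟨ ·ᴵ-expand M′ x′ (ι p) ⟩
      w - (M′ ·ᵥ z′) (ι p) ≈⟨ +-congˡ (-‿cong (trans (M′-ι z′ p) (trans (sum-cong-≋ λ j → *-congˡ {M p j} (Xz′ j)) (·ᵥ-add M z y p)))) ⟩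
      w - ((M ·ᵥ z) p + (M ·ᵥ y) p) ≈⟨ solve 3 (λ w a b → w :- (a :+ b) := (w :- a) :- b) refl w ((M ·ᵥ z) p) ((M ·ᵥ y) p) ⟩
      (w - (M ·ᵥ z) p) - (M ·ᵥ y) p ≈⟨ +-congʳ (·ᴵ-expand M (λ k → x′ (ι {b = b +𝟏} k)) p) ⟨
      (M ·ᴵ (λ k → x′ (ι {b = b +𝟏} k))) p - (M ·ᵥ y) p ∎
      where
      w = x′ (ι {b = b +𝟏} (ι p))
      z z′ : Vector Carrier n
      z j = x′ (ι {b = b +𝟏} (new b j))
      z′ j = x′ (new (b +𝟏) j)

    ·ᴵ-new : ∀ (x′ : BlockVector ((b +𝟏) +𝟏)) j →
             (M′ ·ᴵ x′) (new b j) ≈ x′ (ι {b = b +𝟏} (new b j)) - (X ·ᵥ (λ l → x′ (new (b +𝟏) l))) j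
    ·ᴵ-new x′ j = trans (·ᴵ-expand M′ x′ (new b j)) (+-congˡ (-‿cong (M′-new (λ l → x′ (new (b +𝟏) l)) j)))

    solutionBasis⇒ : ∀ {N} → IsSolutionBasis M q N → IsSolutionBasis M′ q′ (↑ N ∪ New (b +𝟏))
    solutionBasis⇒ {N} ((B , mc , N≐∁B) , x , x-supported , x-solves , x≥0) =
      (↑ B , ↑-complementary mc , ∁-↑ N≐∁B) , x′ , supported , solves , nonneg
      where
      z z′ : Vector Carrier n
      z j = x (new b j)
      z′ = X⁻¹ ·ᵥ λ j → z j + f j
      x′ : BlockVector ((b +𝟏) +𝟏)
      x′ = [ x ∣ z′ ]
      x′-ι : ∀ k → x′ (ι k) ≡ x k
      x′-ι = [∣]-ι x z′
      x′-new : ∀ j → x′ (new (b +𝟏) j) ≡ z′ j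
      x′-new = [∣]-new x z′

      supported : x′ SupportedOn (↑ N ∪ New (b +𝟏))
      supported p p∉ with view {b = b +𝟏} p
      ... | old k  = trans (reflexive (x′-ι k)) (x-supported k λ k∈N → p∉ (inj₁ (k , k∈N , ≡.refl)))
      ... | last j = contradiction (inj₂ (j , ≡.refl)) p∉

      nonneg : ∀ p → 0# ≤ x′ p
      nonneg p with view {b = b +𝟏} p
      ... | old k  = ≡.subst (0# ≤_) (≡.sym (x′-ι k)) (x≥0 k)
      ... | last j = ≡.subst (0# ≤_) (≡.sym (x′-new j)) (sum-nonneg λ l →
              0≤x∧0≤y⇒0≤x*y (X⁻¹≥0 j l) (inj₁ (0≤x∧0<y⇒0<x+y (x≥0 (new b l)) (f>0 l))))

      Xz′ : ∀ j → (X ·ᵥ (λ l → x′ (new (b +𝟏) l))) j ≈ x′ (ι (new b j)) + f j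
      Xz′ j = begin
        (X ·ᵥ (λ l → x′ (new (b +𝟏) l))) j ≈⟨ sum-cong-≋ (λ l → *-congˡ {X j l} (reflexive (x′-new l))) ⟩
        (X ·ᵥ z′) j                        ≈⟨ solve-X (λ j → z j + f j) j ⟩
        z j + f j                          ≈⟨ +-congʳ (reflexive (x′-ι (new b j))) ⟨
        x′ (ι (new b j)) + f j             ∎

      solves : ∀ p → (M′ ·ᴵ x′) p ≈ q′ p
      solves p with view {b = b} p
      ... | old p₀ = begin
        (M′ ·ᴵ x′) (ι p₀) ≈⟨ ·ᴵ-ι x′ f Xz′ p₀ ⟩
        (M ·ᴵ (λ k → x′ (ι k))) p₀ - (M ·ᵥ f) p₀
          ≈⟨ +-congʳ (trans (sumᵇ-cong λ k → *-congˡ {[I∣- M ] p₀ k} (reflexive (x′-ι k))) (x-solves p₀)) ⟩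
        q p₀ - (M ·ᵥ f) p₀ ≡⟨ [∣]-ι (λ p → q p - (M ·ᵥ f) p) (λ j → - f j) p₀ ⟨
        q′ (ι p₀) ∎
      ... | last j = begin
        (M′ ·ᴵ x′) (new b j) ≈⟨ ·ᴵ-new x′ j ⟩
        x′ (ι (new b j)) - (X ·ᵥ (λ l → x′ (new (b +𝟏) l))) j ≈⟨ +-congˡ (-‿cong (Xz′ j)) ⟩
        x′ (ι (new b j)) - (x′ (ι (new b j)) + f j) ≈⟨ solve 2 (λ a f → a :- (a :+ f) := :- f) refl (x′ (ι (new b j))) (f j) ⟩
        - f j                ≡⟨ [∣]-new (λ p → q p - (M ·ᵥ f) p) (λ j → - f j) j ⟨
        q′ (new b j)         ∎

    -- The last rows of the larger system read `z - X z′ = - f`, so every solution satisfies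
    -- `X z′ = z + f`; the remaining rows then reduce to the smaller system.
    solutionBasis⇐ : ∀ {N} → IsSolutionBasis M′ q′ (↑ N ∪ New (b +𝟏)) → IsSolutionBasis M q N
    solutionBasis⇐ {N} ((B′ , mc , N′≐∁B′) , x′ , x′-supported , x′-solves , x′≥0) =
      (_ , ι⁻¹-complementary mc N′≐∁B′ , ι⁻¹-∁ mc N′≐∁B′) , (λ k → x′ (ι k)) , supported , solves , λ k → x′≥0 (ι k)
      where
      supported : (λ k → x′ (ι k)) SupportedOn N
      supported k k∉N = x′-supported (ι k) λ where
        (inj₁ ιk∈↑N)   → k∉N (ι∈↑⁻ ιk∈↑N)
        (inj₂ (j , e)) → ι≢new k {j} e

      Xz′ : ∀ j → (X ·ᵥ (λ l → x′ (new (b +𝟏) l))) j ≈ x′ (ι (new b j)) + f j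
      Xz′ j = begin
        Xz′ⱼ                        ≈⟨ solve 2 (λ z x → x := z :- (z :- x)) refl (x′ (ι (new b j))) Xz′ⱼ ⟩
        x′ (ι (new b j)) - (x′ (ι (new b j)) - Xz′ⱼ) ≈⟨ +-congˡ (-‿cong (·ᴵ-new x′ j)) ⟨
        x′ (ι (new b j)) - (M′ ·ᴵ x′) (new b j)      ≈⟨ +-congˡ (-‿cong (x′-solves (new b j))) ⟩
        x′ (ι (new b j)) - q′ (new b j)
          ≈⟨ +-congˡ (trans (-‿cong (reflexive ([∣]-new (λ p → q p - (M ·ᵥ f) p) (λ j → - f j) j))) (-‿involutive (f j))) ⟩
        x′ (ι (new b j)) + f j      ∎
        where Xz′ⱼ = (X ·ᵥ (λ l → x′ (new (b +𝟏) l))) j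

      solves : ∀ p → (M ·ᴵ (λ k → x′ (ι k))) p ≈ q p
      solves p = begin
        s ≈⟨ solve 2 (λ s m → s := (s :- m) :+ m) refl s ((M ·ᵥ f) p) ⟩
        (s - (M ·ᵥ f) p) + (M ·ᵥ f) p  ≈⟨ +-congʳ (·ᴵ-ι x′ f Xz′ p) ⟨
        (M′ ·ᴵ x′) (ι p) + (M ·ᵥ f) p  ≈⟨ +-congʳ (trans (x′-solves (ι p)) (reflexive ([∣]-ι (λ p → q p - (M ·ᵥ f) p) (λ j → - f j) p))) ⟩
        (q p - (M ·ᵥ f) p) + (M ·ᵥ f) p ≈⟨ solve 2 (λ s m → (s :- m) :+ m := s) refl (q p) ((M ·ᵥ f) p) ⟩
        q p ∎
        where s = (M ·ᴵ (λ k → x′ (ι k))) p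

    -- Transfer of inverses and arcs.

    gY≈gMX : ∀ g l → (g ᵀ· Y) l ≈ sum λ j → (g ᵀ· M) j * X j l
    gY≈gMX g l = trans (sumᵇ-cong λ p → *-congˡ {g p} (sym (MX≈Y p l))) (sumᵇ-sum-assoc g M (λ j → X j l))

    -- The product is `gY - gMX`, which is zero because `MX = Y`. So a lengthened row is orthogonal
    -- to the columns that the larger system adds.
    extend-M′ : ∀ g l → (extend M g ᵀ· M′) l ≈ 0#
    extend-M′ g l = begin
      (extend M g ᵀ· M′) l ≈⟨ sumᵇ-last (λ p → extend M g p * M′ p l) ⟩
      sumᵇ (λ p → extend M g (ι p) * M′ (ι p) l) + sum (λ j → extend M g (new b j) * M′ (new b j) l)
        ≈⟨ +-cong (sumᵇ-cong λ p → reflexive (≡.cong₂ (λ g h → g * h l) ([∣]-ι g gM p) ([∣]-ι Y X p)))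
                  (sum-cong-≋ λ j → reflexive (≡.cong₂ (λ g h → g * h l) ([∣]-new g gM j) ([∣]-new Y X j))) ⟩
      (g ᵀ· Y) l + sum (λ j → - (g ᵀ· M) j * X j l) ≈⟨ +-cong (gY≈gMX g l) (trans (sum-cong-≋ λ j → sym (-‿distribˡ-* ((g ᵀ· M) j) (X j l))) (sym (sum-neg λ j → (g ᵀ· M) j * X j l))) ⟩
      sum (λ j → (g ᵀ· M) j * X j l) - sum (λ j → (g ᵀ· M) j * X j l) ≈⟨ -‿inverseʳ _ ⟩
      0# ∎
      where
      gM : Vector Carrier n
      gM j = - (g ᵀ· M) j

    -- The shift by `Mf` in the old entries contributes `- gMf`, and the new entries `- f` meet
    -- `- gM` and give it back.
    extend-q′ : ∀ g → (sumᵇ λ p → extend M g p * q′ p) ≈ sumᵇ λ p → g p * q p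
    extend-q′ g = begin
      sumᵇ (λ p → extend M g p * q′ p) ≈⟨ sumᵇ-last (λ p → extend M g p * q′ p) ⟩
      sumᵇ (λ p → extend M g (ι p) * q′ (ι p)) + sum (λ j → extend M g (new b j) * q′ (new b j))
        ≈⟨ +-cong (sumᵇ-cong λ p → reflexive (≡.cong₂ _*_ ([∣]-ι g gM p) ([∣]-ι q-Mf (λ j → - f j) p)))
                  (sum-cong-≋ λ j → reflexive (≡.cong₂ _*_ ([∣]-new g gM j) ([∣]-new q-Mf (λ j → - f j) j))) ⟩
      sumᵇ (λ p → g p * q-Mf p) + sum (λ j → - (g ᵀ· M) j * - f j)
        ≈⟨ +-cong (sumᵇ-cong λ p → solve 3 (λ g q m → g :* (q :- m) := g :* q :+ :- (g :* m)) refl (g p) (q p) ((M ·ᵥ f) p))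
                  (sum-cong-≋ λ j → solve 2 (λ g f → :- g :* :- f := g :* f) refl ((g ᵀ· M) j) (f j)) ⟩
      sumᵇ (λ p → g p * q p + - (g p * (M ·ᵥ f) p)) + gMf
        ≈⟨ +-congʳ (trans (sumᵇ-distrib-+ (λ p → g p * q p) λ p → - (g p * (M ·ᵥ f) p)) (+-congˡ (sym (sumᵇ-neg λ p → g p * (M ·ᵥ f) p)))) ⟩
      (gq - sumᵇ (λ p → g p * (M ·ᵥ f) p)) + gMf ≈⟨ +-congʳ (+-congˡ (-‿cong (sumᵇ-sum-assoc g M f))) ⟩
      (gq - gMf) + gMf ≈⟨ solve 2 (λ x y → (x :- y) :+ y := x) refl gq gMf ⟩
      gq ∎
      where
      gM : Vector Carrier n
      gM j = - (g ᵀ· M) j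
      q-Mf : BlockVector b
      q-Mf p = q p - (M ·ᵥ f) p
      gMf gq : Carrier
      gMf = sum λ j → (g ᵀ· M) j * f j
      gq = sumᵇ λ p → g p * q p

    module _ {B : Pred (Idx (b +𝟏)) 0ℓ} where

      ι∈∁↑ : ∀ {k} → k ∈ ∁ B → ι k ∈ ∁ (↑ B)
      ι∈∁↑ k∉B ιk∈↑B = k∉B (ι∈↑⁻ ιk∈↑B)

      new∈∁↑ : ∀ j → new (b +𝟏) j ∈ ∁ (↑ B)
      new∈∁↑ j = new∉↑ {B = B}

      ι∈∁↑⁻ : ∀ {k} → ι k ∈ ∁ (↑ B) → k ∈ ∁ B
      ι∈∁↑⁻ {k} ιk∉↑B k∈B = ιk∉↑B (k , k∈B , ≡.refl)

      module Raise (mc : MaximalComplementary B) {G : Idx (b +𝟏) → BlockVector b} (G-inverse : IsInverse [I∣- M ] (∁ B) G) where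
        private module G = IsInverse G-inverse

        Gι : Idx (b +𝟏) → BlockVector (b +𝟏)
        Gι k = extend M (G k)

        -- The last rows of `[I|-M′] G′ = I` say that `X` times the new rows of `G′` must be the
        -- rows `Gι (new b l)` minus unit rows; this is that right-hand side.
        G-new : Fin n → BlockVector (b +𝟏)
        G-new l c = Gι (new b l) c - δ (new b l) c

        G′ : Idx ((b +𝟏) +𝟏) → BlockVector (b +𝟏)
        G′ = [ Gι ∣ (λ m c → sum λ l → X⁻¹ m l * G-new l c) ]

        G′-ι : ∀ k → G′ (ι k) ≡ Gι k
        G′-ι = [∣]-ι Gι (λ m c → sum λ l → X⁻¹ m l * G-new l c)

        G′-new : ∀ m → G′ (new (b +𝟏) m) ≡ λ c → sum λ l → X⁻¹ m l * G-new l c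
        G′-new = [∣]-new Gι (λ m c → sum λ l → X⁻¹ m l * G-new l c)

        extend-zero : ∀ {g} → (∀ p → g p ≈ 0#) → ∀ c → extend M g c ≈ 0#
        extend-zero {g} g≈0 c = trans (sym (extend-correct M g c)) (sumᵇ≈0 {t = λ p → g p * [I∣- M ] p c} λ p → trans (*-congʳ (g≈0 p)) (zeroˡ _))

        supported′ : ∀ c → (λ k → G′ k c) SupportedOn ∁ (↑ B)
        supported′ c k k∉ with view {b = b +𝟏} k
        ... | old k₀ = trans (reflexive (≡.cong (λ g → g c) (G′-ι k₀))) (extend-zero (λ p → G.supported p k₀ λ k₀∉B → k∉ (ι∈∁↑ k₀∉B)) c)
        ... | last j = contradiction (new∈∁↑ j) k∉

        -- For `k` in `B` the row of `G` is zero by its support, and so is `δ k k′`. All `k` are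
        -- covered because a new row of `G′` mixes the rows `Gι (new b l)` for every `l`, whether or
        -- not `new b l` lies in `B`.
        leftInverse-everywhere : ∀ k {k′} → k′ ∈ ∁ B → Gι k k′ ≈ δ k k′
        leftInverse-everywhere k {k′} k′∉B with decide-∈ mc k
        ... | no k∉B  = trans (sym (extend-correct M (G k) k′)) (G.leftInverse k∉B k′∉B)
        ... | yes k∈B = trans (extend-zero (λ p → G.supported p k λ k∉B → k∉B k∈B) k′)
                              (sym (δ-≢ λ k≡k′ → k′∉B (≡.subst (_∈ B) k≡k′ k∈B)))

        -- Column `c` of `G′` in the form that `·ᴵ-ι` expects, with the negated unit column in the
        -- role of `f`.
        XG′ : ∀ c j → (X ·ᵥ (λ l → G′ (new (b +𝟏) l) c)) j ≈ G′ (ι (new b j)) c + - δ (new b j) c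
        XG′ c j = begin
          (X ·ᵥ (λ l → G′ (new (b +𝟏) l) c)) j ≈⟨ sum-cong-≋ (λ l → *-congˡ {X j l} (reflexive (≡.cong (λ g → g c) (G′-new l)))) ⟩
          (X ·ᵥ (X⁻¹ ·ᵥ λ l → G-new l c)) j     ≈⟨ solve-X (λ l → G-new l c) j ⟩
          G-new j c                             ≈⟨ +-congʳ (reflexive (≡.cong (λ g → g c) (G′-ι (new b j)))) ⟨
          G′ (ι (new b j)) c + - δ (new b j) c  ∎

        rightInverse′ : ∀ p c → (M′ ·ᴵ (λ k → G′ k c)) p ≈ δ p c
        rightInverse′ p c with view {b = b} p
        ... | last j = begin
          (M′ ·ᴵ (λ k → G′ k c)) (new b j) ≈⟨ ·ᴵ-new (λ k → G′ k c) j ⟩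
          G′ (ι (new b j)) c - (X ·ᵥ (λ l → G′ (new (b +𝟏) l) c)) j ≈⟨ +-congˡ (-‿cong (XG′ c j)) ⟩
          G′ (ι (new b j)) c - (G′ (ι (new b j)) c + - δ (new b j) c) ≈⟨ solve 2 (λ g d → g :- (g :+ :- d) := d) refl (G′ (ι (new b j)) c) (δ (new b j) c) ⟩
          δ (new b j) c ∎
        ... | old p₀ = begin
          (M′ ·ᴵ (λ k → G′ k c)) (ι p₀) ≈⟨ ·ᴵ-ι (λ k → G′ k c) (λ j → - δ (new b j) c) (XG′ c) p₀ ⟩
          (M ·ᴵ (λ k → G′ (ι k) c)) p₀ - (M ·ᵥ (λ j → - δ (new b j) c)) p₀
            ≈⟨ +-congʳ (sumᵇ-cong λ k → *-congˡ {[I∣- M ] p₀ k} (reflexive (≡.cong (λ g → g c) (G′-ι k)))) ⟩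
          (M ·ᴵ (λ k → Gι k c)) p₀ - (M ·ᵥ (λ j → - δ (new b j) c)) p₀ ≈⟨ column c ⟩
          δ (ι p₀) c ∎
          where
          column : ∀ c → (M ·ᴵ (λ k → Gι k c)) p₀ - (M ·ᵥ (λ j → - δ (new b j) c)) p₀ ≈ δ (ι p₀) c
          column c with view {b = b} c
          ... | old p₁ = begin
            (M ·ᴵ (λ k → Gι k (ι p₁))) p₀ - (M ·ᵥ (λ j → - δ (new b j) (ι p₁))) p₀
              ≈⟨ +-cong (sumᵇ-cong λ k → *-congˡ {[I∣- M ] p₀ k} (reflexive ([∣]-ι (G k) (λ l → - (G k ᵀ· M) l) p₁)))
                        (-‿cong (sum≈0 {t = λ j → M p₀ j * - δ (new b j) (ι p₁)} λ j →
                          trans (*-congˡ (trans (-‿cong (δ-new-ι j p₁)) -0#≈0#)) (zeroʳ _))) ⟩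
            (M ·ᴵ (λ k → G k p₁)) p₀ - 0# ≈⟨ trans (+-congˡ -0#≈0#) (+-identityʳ _) ⟩
            (M ·ᴵ (λ k → G k p₁)) p₀      ≈⟨ G.rightInverse p₀ p₁ ⟩
            δ p₀ p₁                       ≈⟨ δ-ι p₀ p₁ ⟨
            δ (ι p₀) (ι p₁)               ∎
          -- The right inverse `G` turns the first term into `- M p₀ l`, and the term from the unit
          -- column adds the same entry back.
          ... | last l = begin
            (M ·ᴵ (λ k → Gι k (new b l))) p₀ - (M ·ᵥ (λ j → - δ (new b j) (new b l))) p₀
              ≈⟨ +-cong (sumᵇ-cong λ k → trans (*-congˡ {[I∣- M ] p₀ k} (reflexive ([∣]-new (G k) (λ l → - (G k ᵀ· M) l) l)))
                          (sym (-‿distribʳ-* ([I∣- M ] p₀ k) ((G k ᵀ· M) l))))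
                        (-‿cong (sum-cong-≋ λ j → trans (sym (-‿distribʳ-* (M p₀ j) (δ (new b j) (new b l)))) (-‿cong (*-congˡ {M p₀ j} (δ-new b j l))))) ⟩
            sumᵇ (λ k → - ([I∣- M ] p₀ k * (G k ᵀ· M) l)) - sum (λ j → - (M p₀ j * 𝟙 j l))
              ≈⟨ +-cong (sym (sumᵇ-neg λ k → [I∣- M ] p₀ k * (G k ᵀ· M) l)) (-‿cong (sym (sum-neg λ j → M p₀ j * 𝟙 j l))) ⟩
            - sumᵇ (λ k → [I∣- M ] p₀ k * (G k ᵀ· M) l) - - sum (λ j → M p₀ j * 𝟙 j l)
              ≈⟨ +-cong (-‿cong (trans (sumᵇ-sumᵇ-assoc ([I∣- M ] p₀) G (λ p → M p l))
                          (trans (sumᵇ-cong λ p → *-congʳ {M p l} (G.rightInverse p₀ p)) (sumᵇ-δˡ p₀ λ p → M p l))))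
                        (-‿cong (-‿cong (sum-𝟙ʳ l (M p₀)))) ⟩
            - M p₀ l - - M p₀ l ≈⟨ -‿inverseʳ _ ⟩
            0#                  ≈⟨ δ-ι-new p₀ l ⟨
            δ (ι p₀) (new b l)  ∎

        -- Old rows against old columns repeat the left inverse `G`, and against new columns they
        -- vanish by `extend-M′`. New rows vanish on old columns because `G-new` does, and against
        -- new columns they give `X⁻¹ X`.
        extend-G′ : ∀ {k k′} → k ∈ ∁ (↑ B) → k′ ∈ ∁ (↑ B) → extend M′ (G′ k) k′ ≈ δ k k′
        extend-G′ {k} {k′} k∉ k′∉ with view {b = b +𝟏} k | view {b = b +𝟏} k′
        ... | old k₀ | old k₁ = begin
          extend M′ (G′ (ι k₀)) (ι k₁) ≡⟨ [∣]-ι (G′ (ι k₀)) (λ l → - (G′ (ι k₀) ᵀ· M′) l) k₁ ⟩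
          G′ (ι k₀) k₁                 ≡⟨ ≡.cong (λ g → g k₁) (G′-ι k₀) ⟩
          Gι k₀ k₁                     ≈⟨ leftInverse-everywhere k₀ (ι∈∁↑⁻ k′∉) ⟩
          δ k₀ k₁                      ≈⟨ δ-ι k₀ k₁ ⟨
          δ (ι k₀) (ι k₁)              ∎
        ... | old k₀ | last m = begin
          extend M′ (G′ (ι k₀)) (new (b +𝟏) m) ≡⟨ [∣]-new (G′ (ι k₀)) (λ l → - (G′ (ι k₀) ᵀ· M′) l) m ⟩
          - (G′ (ι k₀) ᵀ· M′) m ≡⟨ ≡.cong (λ g → - (g ᵀ· M′) m) (G′-ι k₀) ⟩
          - (Gι k₀ ᵀ· M′) m     ≈⟨ trans (-‿cong (extend-M′ (G k₀) m)) -0#≈0# ⟩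
          0#                    ≈⟨ δ-ι-new k₀ m ⟨
          δ (ι k₀) (new (b +𝟏) m) ∎
        ... | last m | old k₁ = begin
          extend M′ (G′ (new (b +𝟏) m)) (ι k₁) ≡⟨ [∣]-ι (G′ (new (b +𝟏) m)) (λ l → - (G′ (new (b +𝟏) m) ᵀ· M′) l) k₁ ⟩
          G′ (new (b +𝟏) m) k₁                 ≡⟨ ≡.cong (λ g → g k₁) (G′-new m) ⟩
          sum (λ l → X⁻¹ m l * G-new l k₁)
            ≈⟨ sum≈0 {t = λ l → X⁻¹ m l * G-new l k₁} (λ l → trans (*-congˡ (trans (+-congʳ (leftInverse-everywhere (new b l) (ι∈∁↑⁻ k′∉))) (-‿inverseʳ _))) (zeroʳ _)) ⟩
          0#                                   ≈⟨ δ-new-ι m k₁ ⟨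
          δ (new (b +𝟏) m) (ι k₁)              ∎
        ... | last m | last m′ = begin
          extend M′ (G′ (new (b +𝟏) m)) (new (b +𝟏) m′) ≡⟨ [∣]-new (G′ (new (b +𝟏) m)) (λ l → - (G′ (new (b +𝟏) m) ᵀ· M′) l) m′ ⟩
          - (G′ (new (b +𝟏) m) ᵀ· M′) m′ ≡⟨ ≡.cong (λ g → - (g ᵀ· M′) m′) (G′-new m) ⟩
          - sumᵇ (λ c → (sum λ l → X⁻¹ m l * G-new l c) * M′ c m′) ≈⟨ -‿cong (sum-sumᵇ-assoc (X⁻¹ m) G-new (λ c → M′ c m′)) ⟨
          - sum (λ l → X⁻¹ m l * (G-new l ᵀ· M′) m′)
            ≈⟨ trans (sum-neg λ l → X⁻¹ m l * (G-new l ᵀ· M′) m′) (sum-cong-≋ λ l → trans (-‿distribʳ-* (X⁻¹ m l) ((G-new l ᵀ· M′) m′)) (*-congˡ {X⁻¹ m l} (G-new-M′ l m′))) ⟩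
          sum (λ l → X⁻¹ m l * X l m′) ≈⟨ inverseˡ m m′ ⟩
          𝟙 m m′                       ≈⟨ δ-new (b +𝟏) m m′ ⟨
          δ (new (b +𝟏) m) (new (b +𝟏) m′) ∎
          where
          G-new-M′ : ∀ l m → - (G-new l ᵀ· M′) m ≈ X l m
          G-new-M′ l m = begin
            - (G-new l ᵀ· M′) m ≈⟨ sumᵇ-neg (λ c → G-new l c * M′ c m) ⟩
            sumᵇ (λ c → - (G-new l c * M′ c m))
              ≈⟨ sumᵇ-cong (λ c → solve 3 (λ g d h → :- ((g :- d) :* h) := d :* h :+ :- (g :* h)) refl (Gι (new b l) c) (δ (new b l) c) (M′ c m)) ⟩
            sumᵇ (λ c → δ (new b l) c * M′ c m + - (Gι (new b l) c * M′ c m))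
              ≈⟨ trans (sumᵇ-distrib-+ (λ c → δ (new b l) c * M′ c m) (λ c → - (Gι (new b l) c * M′ c m)))
                       (+-cong (sumᵇ-δˡ (new b l) λ c → M′ c m) (sym (sumᵇ-neg λ c → Gι (new b l) c * M′ c m))) ⟩
            M′ (new b l) m - (Gι (new b l) ᵀ· M′) m
              ≈⟨ +-cong (reflexive (≡.cong (λ h → h m) ([∣]-new Y X l))) (trans (-‿cong (extend-M′ (G (new b l)) m)) -0#≈0#) ⟩
            X l m + 0# ≈⟨ +-identityʳ _ ⟩
            X l m ∎

        raised : IsInverse [I∣- M′ ] (∁ (↑ B)) G′
        raised = record
          { supported    = supported′
          ; rightInverse = rightInverse′
          ; leftInverse  = λ {k} {k′} k∉ k′∉ → trans (extend-correct M′ (G′ k) k′) (extend-G′ k∉ k′∉)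
          }

        raised-q′ : ∀ k → (sumᵇ λ p → G′ (ι k) p * q′ p) ≈ sumᵇ λ p → G k p * q p
        raised-q′ k = trans (reflexive (≡.cong (λ g → sumᵇ λ p → g p * q′ p) (G′-ι k))) (extend-q′ (G k))

      module Restrict {G′ : Idx ((b +𝟏) +𝟏) → BlockVector (b +𝟏)} (G′-inverse : IsInverse [I∣- M′ ] (∁ (↑ B)) G′) where
        private module G′ = IsInverse G′-inverse

        G : Idx (b +𝟏) → BlockVector b
        G k p = G′ (ι k) (ι p)

        -- Column (j , bⱼ + 2) of the left inverse says g Y + h X = 0 for the two parts g, h
        -- of row k of G′, that is (g M + h) X = 0.
        G′-extend : ∀ {k} → k ∈ ∁ B → ∀ c → G′ (ι k) c ≈ extend M (G k) c
        G′-extend {k} k∉B c with view {b = b} c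
        ... | old p  = sym (reflexive ([∣]-ι (G k) (λ l → - (G k ᵀ· M) l) p))
        ... | last j = begin
          h j                       ≈⟨ solve 2 (λ h g → h := (g :+ h) :- g) refl (h j) ((G k ᵀ· M) j) ⟩
          ((G k ᵀ· M) j + h j) - (G k ᵀ· M) j ≈⟨ +-congʳ (gM+h≈0 j) ⟩
          0# - (G k ᵀ· M) j         ≈⟨ +-identityˡ _ ⟩
          - (G k ᵀ· M) j            ≡⟨ [∣]-new (G k) (λ l → - (G k ᵀ· M) l) j ⟨
          extend M (G k) (new b j)  ∎
          where
          h u : Vector Carrier n
          h j = G′ (ι k) (new b j)
          u j = (G k ᵀ· M) j + h j

          uX≈0 : ∀ l → sum (λ j → u j * X j l) ≈ 0#
          uX≈0 l = begin
            sum (λ j → u j * X j l)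
              ≈⟨ trans (sum-cong-≋ λ j → distribʳ (X j l) ((G k ᵀ· M) j) (h j)) (∑-distrib-+ (λ j → (G k ᵀ· M) j * X j l) (λ j → h j * X j l)) ⟩
            sum (λ j → (G k ᵀ· M) j * X j l) + sum (λ j → h j * X j l) ≈⟨ +-congʳ (gY≈gMX (G k) l) ⟨
            (G k ᵀ· Y) l + sum (λ j → h j * X j l)
              ≈⟨ +-cong (sumᵇ-cong λ p → *-congˡ {G k p} (reflexive (≡.cong (λ r → r l) ([∣]-ι Y X p))))
                        (sum-cong-≋ λ j → *-congˡ {h j} (reflexive (≡.cong (λ r → r l) ([∣]-new Y X j)))) ⟨
            sumᵇ (λ p → G′ (ι k) (ι p) * M′ (ι p) l) + sum (λ j → h j * M′ (new b j) l) ≈⟨ sumᵇ-last (λ p → G′ (ι k) p * M′ p l) ⟨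
            (G′ (ι k) ᵀ· M′) l     ≈⟨ -‿involutive _ ⟨
            - - (G′ (ι k) ᵀ· M′) l ≈⟨ -‿cong (begin
              - (G′ (ι k) ᵀ· M′) l ≡⟨ [∣]-new (G′ (ι k)) (λ l → - (G′ (ι k) ᵀ· M′) l) l ⟨
              extend M′ (G′ (ι k)) (new (b +𝟏) l) ≈⟨ extend-correct M′ (G′ (ι k)) (new (b +𝟏) l) ⟨
              sumᵇ (λ p → G′ (ι k) p * [I∣- M′ ] p (new (b +𝟏) l)) ≈⟨ G′.leftInverse (ι∈∁↑ k∉B) (new∈∁↑ l) ⟩
              δ (ι k) (new (b +𝟏) l) ≈⟨ δ-ι-new k l ⟩
              0# ∎) ⟩
            - 0# ≈⟨ -0#≈0# ⟩
            0# ∎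

          gM+h≈0 : ∀ j → u j ≈ 0#
          gM+h≈0 j = begin
            u j                       ≈⟨ sum-𝟙ʳ j u ⟨
            sum (λ i → u i * 𝟙 i j)   ≈⟨ sum-cong-≋ (λ i → *-congˡ {u i} (inverseʳ i j)) ⟨
            sum (λ i → u i * sum λ l → X i l * X⁻¹ l j) ≈⟨ sum-assoc u X (λ l → X⁻¹ l j) ⟩
            sum (λ l → (sum λ i → u i * X i l) * X⁻¹ l j) ≈⟨ sum≈0 {t = λ l → (sum λ i → u i * X i l) * X⁻¹ l j} (λ l → trans (*-congʳ (uX≈0 l)) (zeroˡ _)) ⟩
            0#                        ∎

        -- In the column `ι p′` the last rows of the larger identity matrix are zero, hence
        -- `X z′ = z` there, and `·ᴵ-ι` applies with a zero shift.
        rightInverse₀ : ∀ p p′ → (M ·ᴵ (λ k → G k p′)) p ≈ δ p p′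
        rightInverse₀ p p′ = begin
          (M ·ᴵ (λ k → G k p′)) p ≈⟨ trans (+-congˡ (trans (-‿cong (sum≈0 {t = λ j → M p j * 0#} λ j → zeroʳ _)) -0#≈0#)) (+-identityʳ _) ⟨
          (M ·ᴵ (λ k → G k p′)) p - (M ·ᵥ (λ _ → 0#)) p ≈⟨ ·ᴵ-ι x′ (λ _ → 0#) Xz′ p ⟨
          (M′ ·ᴵ x′) (ι p)        ≈⟨ G′.rightInverse (ι p) (ι p′) ⟩
          δ (ι p) (ι p′)          ≈⟨ δ-ι p p′ ⟩
          δ p p′                  ∎
          where
          x′ : BlockVector ((b +𝟏) +𝟏)
          x′ k = G′ k (ι p′)
          Xz′ : ∀ j → (X ·ᵥ (λ l → x′ (new (b +𝟏) l))) j ≈ x′ (ι (new b j)) + 0#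
          Xz′ j = begin
            Xz′ⱼ ≈⟨ solve 2 (λ z x → x := z :- (z :- x)) refl (x′ (ι (new b j))) Xz′ⱼ ⟩
            x′ (ι (new b j)) - (x′ (ι (new b j)) - Xz′ⱼ) ≈⟨ +-congˡ (-‿cong (·ᴵ-new x′ j)) ⟨
            x′ (ι (new b j)) - (M′ ·ᴵ x′) (new b j) ≈⟨ +-congˡ (trans (-‿cong (trans (G′.rightInverse (new b j) (ι p′)) (δ-new-ι j p′))) -0#≈0#) ⟩
            x′ (ι (new b j)) + 0# ∎
            where Xz′ⱼ = (X ·ᵥ (λ l → x′ (new (b +𝟏) l))) j

        restricted : IsInverse [I∣- M ] (∁ B) G
        restricted = record
          { supported    = λ p k k∈ → G′.supported (ι p) (ι k) λ ιk∉ → k∈ (ι∈∁↑⁻ ιk∉)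
          ; rightInverse = rightInverse₀
          ; leftInverse  = λ {k} {k′} k∉B k′∉B → begin
              sumᵇ (λ p → G k p * [I∣- M ] p k′) ≈⟨ extend-correct M (G k) k′ ⟩
              extend M (G k) k′                  ≈⟨ G′-extend k∉B k′ ⟨
              G′ (ι k) k′                        ≡⟨ [∣]-ι (G′ (ι k)) (λ l → - (G′ (ι k) ᵀ· M′) l) k′ ⟨
              extend M′ (G′ (ι k)) (ι k′)        ≈⟨ extend-correct M′ (G′ (ι k)) (ι k′) ⟨
              sumᵇ (λ p → G′ (ι k) p * [I∣- M′ ] p (ι k′)) ≈⟨ G′.leftInverse (ι∈∁↑ k∉B) (ι∈∁↑ k′∉B) ⟩
              δ (ι k) (ι k′)                     ≈⟨ δ-ι k k′ ⟩
              δ k k′                             ∎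
          }

        restricted-q′ : ∀ {k} → k ∈ ∁ B → (sumᵇ λ p → G′ (ι k) p * q′ p) ≈ sumᵇ λ p → G k p * q p
        restricted-q′ {k} k∉B = trans (sumᵇ-cong λ p → *-congʳ {q′ p} (G′-extend k∉B p)) (extend-q′ (G k))

    arc⇒ : ∀ {B C} → MaximalComplementary B → (M , q ⊢ B ⟶ C) → (M′ , q′ ⊢ ↑ B ⟶ ↑ C)
    arc⇒ mc (j , i , k , ji∈B , jk∉B , exchange , G , G-inverse , Gq<0) =
      j , i ↑ˡ 1 , k ↑ˡ 1 , (_ , ji∈B , ≡.refl) , jk∉B ∘ ι∈↑⁻ , exchange-↑ exchange ,
      G′ , raised , <.<-respˡ-≈ (sym (raised-q′ (j , k))) Gq<0
      where open Raise mc G-inverse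

    -- An arc between sets of the form `↑ B` and `↑ C` exchanges old elements only: the removed one
    -- lies in `↑ B`, the inserted one in `↑ C`. Hence the deciding row of `G′` has an old index.
    arc⇐ : ∀ {B C} → (M′ , q′ ⊢ ↑ B ⟶ ↑ C) → (M , q ⊢ B ⟶ C)
    arc⇐ {B} {C} (j , i′ , k′ , ji′∈↑B , jk′∉↑B , exchange , G′ , G′-inverse , G′q′<0) =
      from ji′∈↑B (proj₂ exchange (inj₂ ≡.refl)) jk′∉↑B exchange G′q′<0 ≡.refl
      where
      open Restrict G′-inverse
      from : ∀ {p k} → p ∈ ↑ B → k ∈ ↑ C → k ∉ ↑ B → ↑ C ≐ ((↑ B ∖ ｛ p ｝) ∪ ｛ k ｝) →
             (sumᵇ λ c → G′ k c * q′ c) < 0# → proj₁ p ≡ proj₁ k → (M , q ⊢ B ⟶ C)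
      from ((j , i) , ji∈B , ≡.refl) ((j , k) , _ , ≡.refl) jk∉↑B exchange G′q′<0 ≡.refl =
        j , i , k , ji∈B , jk∉B , exchange-↑⁻ exchange , G , restricted , <.<-respˡ-≈ (restricted-q′ jk∉B) G′q′<0
        where
        jk∉B : (j , k) ∉ B
        jk∉B jk∈B = jk∉↑B (_ , jk∈B , ≡.refl)

theorem6p1 :
  ∀ {c ℓ₁ ℓ₂} (F : OrderedField c ℓ₁ ℓ₂) →
  let open OrderedField F
      open GLCP F
  in
  ∀ n (b : Vector ℕ n) → (∀ j → NonZero (b j)) →
  (M : BlockMatrix b) (q : BlockVector b) →
  (X : SquareMatrix n) (Y : BlockMatrix b) → IsHiddenKWitness M X Y →
  (f : Vector Carrier n) → (∀ j → 0# < f j) →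
  let M′ = [ Y ∣ X ]
      q′ = [ (λ p → q p - (M ·ᵥ f) p) ∣ (λ j → - f j) ]
  in
  IsBlockKMatrix M′ ×
  ((N : Pred (Idx (b +𝟏)) 0ℓ) →
    IsSolutionBasis M q N ⇔ IsSolutionBasis M′ q′ (↑ N ∪ New (b +𝟏))) ×
  (Nondegenerate M q → Nondegenerate M′ q′ →
    (B C : Pred (Idx (b +𝟏)) 0ℓ) →
    MaximalComplementary B → MaximalComplementary C →
    (M , q ⊢ B ⟶ C) ⇔ (M′ , q′ ⊢ ↑ B ⟶ ↑ C))
theorem6p1 F n b b≢0 M q X Y ((_ , M-isP) , r , s , witness) f f>0 =
  M′-isK r s r≥0 s≥0 Xᵀr+Yᵀs>0 ,
  (λ N → mk⇔ solutionBasis⇒ solutionBasis⇐) ,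
  λ _ _ B C B-complementary _ → mk⇔ (arc⇒ B-complementary) arc⇐
  where
  open Theory F
  open GLCP F
  open IsHiddenZWitness witness
  open Joint M X Y MX≈Y
  open Walk b≢0 M-isP X-isZ Y-isZ
  open Correspondence M q X Y MX≈Y (X-inverse r s r≥0 s≥0 Xᵀr+Yᵀs>0) f f>0
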